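{- There exists a deterministic algorithm for the fully-dynamic graphical carpooling problem on $n$ vertices which, against an adaptive adversary, maintains at all times an orientation $H_t$ of the current graph $G_t$ with discrepancy $\max_{v \in V} |\deg^+_{H_t}(v) - \deg^-_{H_t}(v)| \le 3$, and whose worst-case recourse per update (insertion or deletion) is $O(\log^2 n)$.
   Context: Fully-dynamic graphical carpooling: $V$ is a fixed vertex set with $|V| = n$. Starting from the empty (multi)graph $G_0 = (V, \emptyset)$, at each time $t$ an adaptive adversary (who may choose updates based on the algorithm's past behaviour) chooses an edge $e_t \in V \times V$ and either inserts it, giving $G_t = G_{t-1} \cup e_t$, or deletes an existing edge, giving $G_t = G_{t-1} \setminus e_t$; multi-edges are allowed. After each update the algorithm must output an orientation $H_t$ of $G_t$ (each edge is directed one way). $\deg^+_H(v)$ and $\deg^-_H(v)$ denote out-degree and in-degree of $v$ in $H$. The discrepancy of $H$ is $\max_{v\in V}|\deg^+_H(v)-\deg^-_H(v)|$. The algorithm may change orientations of existing edges after each update; the recourse of an update is the number of edges whose orientation is changed in that step. The guarantees do not depend on the number of updates. -}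

module Defs where

open import Data.Nat using (ℕ; zero; suc; _+_; _*_; _^_; _≤_)
open import Data.Nat.Logarithm using (⌊log₂_⌋)
open import Data.Integer using (ℤ; _⊖_; ∣_∣)
open import Data.Fin using (Fin; toℕ)
open import Data.Fin.Properties using (_≟_)
open import Data.Bool using (Bool; true; false; if_then_else_)
open import Data.Product using (_×_; _,_; Σ; ∃-syntax)
open import Data.List using (List; []; _∷_; _++_; [_]; length)
open import Relation.Nullary using (yes; no)
open import Relation.Binary.PropositionalEquality using (_≡_)

-- An (undirected) edge between two vertices of V = Fin n, given as an
-- ordered pair (u , v) only so that an orientation bit can refer to it.
Edge : ℕ → Set
Edge n = Fin n × Fin n

-- The current multigraph G_t: list of its edges (multi-edges and loops allowed).
Graph : ℕ → Set
Graph n = List (Edge n)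

dropAt : {A : Set} → ℕ → List A → List A
dropAt _       []       = []
dropAt zero    (x ∷ xs) = xs
dropAt (suc i) (x ∷ xs) = x ∷ dropAt i xs

data Update {n : ℕ} (G : Graph n) : Set where
  ins : Edge n → Update G
  del : Fin (length G) → Update G

apply : {n : ℕ} (G : Graph n) → Update G → Graph n
apply G (ins e) = G ++ [ e ]
apply G (del i) = dropAt (toℕ i) G

-- Histories of updates starting from the empty graph G_0, indexed by the
-- current graph. An adaptive adversary may produce any such history.
data History (n : ℕ) : Graph n → Set where
  start : History n []
  _▷_   : {G : Graph n} → History n G → (u : Update G) → History n (apply G u)

-- A deterministic online algorithm: its output after each update is a function
-- of the history so far. An orientation of G is a list of bits, one per edge:
-- true means (u , v) is oriented u → v, false means v → u.
Algorithm : Set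
Algorithm = (n : ℕ) → {G : Graph n} → History n G → List Bool

tail head : {n : ℕ} → Edge n → Bool → Fin n
tail (u , v) true  = u
tail (u , v) false = v
head (u , v) true  = v
head (u , v) false = u

indicator : {n : ℕ} → Fin n → Fin n → ℕ
indicator w x with w ≟ x
... | yes _ = 1
... | no  _ = 0

outdeg indeg : {n : ℕ} → Graph n → List Bool → Fin n → ℕ
outdeg (e ∷ G) (b ∷ bs) w = indicator w (tail e b) + outdeg G bs w
outdeg _       _        w = 0
indeg  (e ∷ G) (b ∷ bs) w = indicator w (head e b) + indeg G bs w
indeg  _       _        w = 0

DiscrepancyAtMost : {n : ℕ} → ℕ → Graph n → List Bool → Set
DiscrepancyAtMost {n} d G o = (w : Fin n) → ∣ outdeg G o w ⊖ indeg G o w ∣ ≤ d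

mismatches : List Bool → List Bool → ℕ
mismatches (a ∷ as) (b ∷ bs) = (if a Data.Bool.xor b then 1 else 0) + mismatches as bs
mismatches _        _        = 0

-- The previous orientation, restricted to the edges surviving the update,
-- aligned with the positions of the new graph (a newly inserted edge is last
-- and is not counted: its first orientation is not a change).
carried : {n : ℕ} {G : Graph n} → Update G → List Bool → List Bool
carried (ins e) o = o
carried (del i) o = dropAt (toℕ i) o

recourse : {n : ℕ} {G : Graph n} → Update G → List Bool → List Bool → ℕ
recourse u old new = mismatches (carried u old) new

-- Every edge is either owned by one of its ends, which has two slots for such edges, or
-- belongs to a block, a set of edges oriented as a closed trail. Blocks have no imbalance,
-- the at most two edges owned by a vertex contribute at most 2 to its discrepancy, and the
-- edges at a vertex that are owned by its neighbours are kept balanced up to 1 at the price of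
-- one flip per change of ownership. To place a new edge at u, follow owned edges away from
-- u: with K = 1 + ⌊log₂ n⌋ there are 2^K > n walks of length K unless a vertex with a
-- free slot shows up. In the latter case shifting the ownership along the walk frees a slot at u.
-- Otherwise two walks have the same end, so some closed trail of at most 2K owned edges is
-- reachable from u; it becomes a block, which frees slots on it. So placing an edge
-- costs O(K) flips. Deleting an edge of a block dissolves this block, and its at most 2K
-- edges are placed again, at a total cost of O(K²).

{-# OPTIONS --safe #-}
module Submission where

open import Defs
open import Data.Nat using (ℕ; zero; suc; _+_; _*_; _^_; _≤_; _<_; z≤n; s≤s)
import Data.Nat.Properties as ℕₚ
open import Data.Nat.Tactic.RingSolver using () renaming (solve-∀ to ℕ-solve-∀)
open import Data.Nat.Logarithm using (⌊log₂_⌋; ⌊log₂⌋-mono-≤; ⌊log₂[2^n]⌋≡n)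
open import Data.Integer as ℤ using (ℤ; +_; -[1+_]; ∣_∣; _⊖_; 0ℤ; 1ℤ)
  renaming (_+_ to infixl 6 _+ℤ_; _-_ to infixl 6 _-ℤ_; -_ to infix 8 -ℤ_)
import Data.Integer.Properties as ℤₚ
open import Data.Integer.Tactic.RingSolver using (solve-∀)
open import Data.Bool using (Bool; true; false; not; _xor_; if_then_else_)
open import Data.Fin using (Fin; zero; suc; toℕ; fromℕ; cast; combine; punchIn; punchOut; finToFun; funToFin)
open import Data.Fin.Properties using (_≟_; <⇒≢; any?; pigeonhole; funToFin-finToFin; punchIn-injective; punchIn-punchOut; punchInᵢ≢i; toℕ-cast)
open import Data.Product using (_×_; _,_; proj₁; proj₂; ∃-syntax; Σ-syntax)
open import Data.Sum using (_⊎_; inj₁; inj₂)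
open import Data.Maybe using (Maybe; just; nothing)
open import Data.List using (List; []; _∷_; _++_; [_]; length; tabulate; map)
import Data.List.Properties as Listₚ
open import Data.List.Membership.Propositional using (_∈_; _∉_)
open import Data.List.Membership.Propositional.Properties using (∈-++⁺ˡ; ∈-++⁺ʳ; ∈-++⁻; ∈-map⁺)
import Data.List.Membership.DecPropositional as DecMembership
open import Data.List.Relation.Unary.Any using (here; there)
import Data.List.Relation.Unary.All as All
open import Data.List.Relation.Unary.AllPairs using ([]; _∷_)
open import Data.List.Relation.Unary.Unique.Propositional using (Unique)
open import Data.Vec.Functional using (updateAt)
open import Data.Vec.Functional.Properties using (updateAt-updates; updateAt-minimal)
open import Algebra.Properties.CommutativeMonoid.Sum ℤₚ.+-0-commutativeMonoid
  using (sum; sum-cong-≗; ∑-distrib-+; sum-remove)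
open import Data.Empty using (⊥; ⊥-elim)
open import Data.Unit using (⊤; tt)
open import Function using (_∘_; case_of_)
open import Relation.Nullary using (¬_; Dec; yes; no)
open import Relation.Binary.PropositionalEquality
  using (_≡_; _≢_; refl; sym; trans; cong; cong₂; subst; subst₂; module ≡-Reasoning)

private variable
  n m : ℕ

-- Finite sums of integers.

sum-update : (g g' : Fin m → ℤ) (f : Fin m) → (∀ i → i ≢ f → g' i ≡ g i) →
  sum g' ≡ sum g +ℤ (g' f -ℤ g f)
sum-update g g' zero same = begin
  g' zero +ℤ sum (g' ∘ suc)                          ≡⟨ cong (g' zero +ℤ_) (sum-cong-≗ (λ i → same (suc i) λ ())) ⟩
  g' zero +ℤ sum (g ∘ suc)                           ≡⟨ rearrange (g' zero) (g zero) (sum (g ∘ suc)) ⟩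
  g zero +ℤ sum (g ∘ suc) +ℤ (g' zero -ℤ g zero)   ∎
  where
  open ≡-Reasoning
  rearrange : ∀ a b c → a +ℤ c ≡ b +ℤ c +ℤ (a -ℤ b)
  rearrange = solve-∀
sum-update g g' (suc f) same = begin
  g' zero +ℤ sum (g' ∘ suc)
    ≡⟨ cong₂ _+ℤ_ (same zero λ ()) (sum-update (g ∘ suc) (g' ∘ suc) f λ i i≢f → same (suc i) λ { refl → i≢f refl }) ⟩
  g zero +ℤ (sum (g ∘ suc) +ℤ (g' (suc f) -ℤ g (suc f)))
    ≡⟨ ℤₚ.+-assoc (g zero) _ _ ⟨
  g zero +ℤ sum (g ∘ suc) +ℤ (g' (suc f) -ℤ g (suc f)) ∎
  where open ≡-Reasoning

sum-zero : (g : Fin m → ℤ) → (∀ i → g i ≡ 0ℤ) → sum g ≡ 0ℤ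
sum-zero {zero}  g g≡0 = refl
sum-zero {suc m} g g≡0 = cong₂ _+ℤ_ (g≡0 zero) (sum-zero (g ∘ suc) (g≡0 ∘ suc))

sum-neg : (g : Fin m → ℤ) → sum (λ i → -ℤ g i) ≡ -ℤ sum g
sum-neg {zero}  g = refl
sum-neg {suc m} g = trans (cong ((-ℤ g zero) +ℤ_) (sum-neg (g ∘ suc))) (sym (ℤₚ.neg-distrib-+ (g zero) _))

-- Used for the share of one slot of a vertex: by `Proper` at most one edge sits in the slot, so at
-- most one term of the sum is nonzero.
sum-single : (g : Fin m → ℤ) → (∀ i → ∣ g i ∣ ≤ 1) → (∀ i j → g i ≢ 0ℤ → g j ≢ 0ℤ → i ≡ j) → ∣ sum g ∣ ≤ 1
sum-single {zero}  g small single = z≤n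
sum-single {suc m} g small single with g zero ℤₚ.≟ 0ℤ
... | yes g0≡0 = subst (λ x → ∣ x ∣ ≤ 1) (sym (trans (cong (_+ℤ sum (g ∘ suc)) g0≡0) (ℤₚ.+-identityˡ (sum (g ∘ suc)))))
  (sum-single (g ∘ suc) (small ∘ suc) λ i j gi gj → case single (suc i) (suc j) gi gj of λ { refl → refl })
... | no g0≢0 = subst (λ x → ∣ x ∣ ≤ 1) (sym (trans (cong (g zero +ℤ_) (sum-zero (g ∘ suc) rest)) (ℤₚ.+-identityʳ (g zero))))
  (small zero)
  where
  rest : ∀ i → g (suc i) ≡ 0ℤ
  rest i with g (suc i) ℤₚ.≟ 0ℤ
  ... | yes p = p
  ... | no ¬p = case single zero (suc i) g0≢0 ¬p of λ ()

positive-term : (g : Fin m → ℤ) → 0ℤ ℤ.< sum g → ∃[ i ] 0ℤ ℤ.< g i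
positive-term {zero}  g (ℤ.+<+ ())
positive-term {suc m} g pos with 0ℤ ℤ.<? g zero
... | yes p = zero , p
... | no ¬p with i , q ← positive-term (g ∘ suc) (ℤₚ.<-≤-trans pos
      (subst (sum g ℤ.≤_) (ℤₚ.+-identityˡ (sum (g ∘ suc))) (ℤₚ.+-monoˡ-≤ (sum (g ∘ suc)) (ℤₚ.≮⇒≥ ¬p)))) = suc i , q

negative-term : (g : Fin m → ℤ) → sum g ℤ.< 0ℤ → ∃[ i ] g i ℤ.< 0ℤ
negative-term g neg
  with i , p ← positive-term (λ i → -ℤ g i) (subst (0ℤ ℤ.<_) (sym (sum-neg g)) (ℤₚ.neg-mono-< neg))
  = i , subst (ℤ._< 0ℤ) (ℤₚ.neg-involutive (g i)) (ℤₚ.neg-mono-< p)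

∣+∣≤ : ∀ {a b} x y → ∣ x ∣ ≤ a → ∣ y ∣ ≤ b → ∣ x +ℤ y ∣ ≤ a + b
∣+∣≤ x y p q = ℕₚ.≤-trans (ℤₚ.∣i+j∣≤∣i∣+∣j∣ x y) (ℕₚ.+-mono-≤ p q)

-- Counting flipped bits.

mismatches-refl : ∀ bs → mismatches bs bs ≡ 0
mismatches-refl []           = refl
mismatches-refl (true ∷ bs)  = mismatches-refl bs
mismatches-refl (false ∷ bs) = mismatches-refl bs

flips : (Fin m → Bool) → (Fin m → Bool) → ℕ
flips o o' = mismatches (tabulate o) (tabulate o')

bit-triangle : ∀ a b c → (if a xor c then 1 else 0) ≤ (if a xor b then 1 else 0) + (if b xor c then 1 else 0)
bit-triangle true  true  true  = z≤n
bit-triangle true  true  false = s≤s z≤n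
bit-triangle true  false true  = z≤n
bit-triangle true  false false = s≤s z≤n
bit-triangle false true  true  = s≤s z≤n
bit-triangle false true  false = z≤n
bit-triangle false false true  = s≤s z≤n
bit-triangle false false false = z≤n

flips-triangle : (o o' o'' : Fin m → Bool) → flips o o'' ≤ flips o o' + flips o' o''
flips-triangle {zero}  o o' o'' = z≤n
flips-triangle {suc m} o o' o'' = ℕₚ.≤-trans
  (ℕₚ.+-mono-≤ (bit-triangle (o zero) (o' zero) (o'' zero)) (flips-triangle (o ∘ suc) (o' ∘ suc) (o'' ∘ suc)))
  (ℕₚ.≤-reflexive (interchange (if o zero xor o' zero then 1 else 0) _ _ _))
  where
  interchange : ∀ a b c d → a + b + (c + d) ≡ a + c + (b + d)
  interchange = ℕ-solve-∀

flips-≗ : (o o' : Fin m → Bool) → (∀ i → o' i ≡ o i) → flips o o' ≡ 0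
flips-≗ o o' eq = trans (cong (mismatches (tabulate o)) (Listₚ.tabulate-cong eq)) (mismatches-refl (tabulate o))

flips-update : (o o' : Fin m → Bool) (f : Fin m) → (∀ i → i ≢ f → o' i ≡ o i) → flips o o' ≤ 1
flips-update {suc m} o o' zero same
  rewrite flips-≗ (o ∘ suc) (o' ∘ suc) (λ i → same (suc i) λ ()) with o zero xor o' zero
... | true  = s≤s z≤n
... | false = z≤n
flips-update {suc m} o o' (suc f) same rewrite same zero (λ ()) with o zero
... | true  = flips-update (o ∘ suc) (o' ∘ suc) f λ i i≢f → same (suc i) λ { refl → i≢f refl }
... | false = flips-update (o ∘ suc) (o' ∘ suc) f λ i i≢f → same (suc i) λ { refl → i≢f refl }

-- Labels of edges, and the parts into which the contribution of an edge is split.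

Slot : Set
Slot = Fin 2

-- The label of an edge: not yet placed, owned by its end `tail e s` through one of
-- that vertex's two slots, or part of the block (a closed trail) numbered z.
data Label : Set where
  limbo : Label
  own   : (s : Bool) (k : Slot) → Label
  block : (z : ℕ) → Label

Cell : Set
Cell = Bool × Label

bit : Cell → Bool
bit = proj₁

lab : Cell → Label
lab = proj₂

-- The view keeps the bit of a block edge and forgets everything about the other edges. An equality
-- of views thus allows owned edges to flip or change owner, while every block keeps its edges and
-- its orientation.
blockView : Cell → Maybe (Bool × ℕ)
blockView (b , block z) = just (b , z)
blockView (b , _)       = nothing

ownView : Cell → Maybe (Bool × Bool × Slot)
ownView (b , own s k) = just (b , s , k)
ownView (b , _)       = nothing

signed : Bool → ℤ → ℤ
signed true  x = x
signed false x = -ℤ x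

ι : Fin n → Fin n → ℤ
ι w x = + indicator w x

ι-other : {w x : Fin n} → w ≢ x → ι w x ≡ 0ℤ
ι-other {w = w} {x} w≢x with w ≟ x
... | yes p = ⊥-elim (w≢x p)
... | no _  = refl

∣ι∣≤1 : (w x : Fin n) → ∣ ι w x ∣ ≤ 1
∣ι∣≤1 w x with w ≟ x
... | yes _ = s≤s z≤n
... | no _  = z≤n

∣signed∣ : ∀ b x → ∣ signed b x ∣ ≡ ∣ x ∣
∣signed∣ true  x = refl
∣signed∣ false x = ℤₚ.∣-i∣≡∣i∣ x

signed-0 : ∀ b {x} → x ≡ 0ℤ → signed b x ≡ 0ℤ
signed-0 true  refl = refl
signed-0 false refl = refl

signed-not : ∀ b x → signed (not b) x ≡ -ℤ signed b x
signed-not true  x = refl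
signed-not false x = sym (ℤₚ.neg-involutive x)

net : Fin n → Edge n → Bool → ℤ
net w e b = ι w (tail e b) -ℤ ι w (head e b)

-- The contribution of an owned edge is split between its two ends: `childNet` is
-- the part at the end that does not own it, `ownNet k` the part at its owner.
childNet : Fin n → Edge n → Cell → ℤ
childNet w e (b , own s k) = signed (b xor s) (ι w (head e s))
childNet w e _             = 0ℤ

ownNet : Slot → Fin n → Edge n → Cell → ℤ
ownNet k w e (b , own s k') with k ≟ k'
... | yes _ = signed (not (b xor s)) (ι w (tail e s))
... | no _  = 0ℤ
ownNet k w e _ = 0ℤ

blockNet : (ℕ → Bool) → Fin n → Edge n → Maybe (Bool × ℕ) → ℤ
blockNet p w e (just (b , z)) = if p z then net w e b else 0ℤ
blockNet p w e nothing        = 0ℤ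

childNet-small : (w : Fin n) (e : Edge n) (c : Cell) → ∣ childNet w e c ∣ ≤ 1
childNet-small w e (b , limbo)   = z≤n
childNet-small w e (b , own s k) = subst (_≤ 1) (sym (∣signed∣ (b xor s) _)) (∣ι∣≤1 w (head e s))
childNet-small w e (b , block z) = z≤n

ownNet-small : (k : Slot) (w : Fin n) (e : Edge n) (c : Cell) → ∣ ownNet k w e c ∣ ≤ 1
ownNet-small k w e (b , limbo)   = z≤n
ownNet-small k w e (b , block z) = z≤n
ownNet-small k w e (b , own s k') with k ≟ k'
... | yes _ = subst (_≤ 1) (sym (∣signed∣ (not (b xor s)) _)) (∣ι∣≤1 w (tail e s))
... | no _  = z≤n

ownNet-owner : (k : Slot) (w : Fin n) (e : Edge n) (c : Cell) → ownNet k w e c ≢ 0ℤ →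
  ∃[ s ] lab c ≡ own s k × tail e s ≡ w
ownNet-owner k w e (b , limbo)   ≢0 = ⊥-elim (≢0 refl)
ownNet-owner k w e (b , block z) ≢0 = ⊥-elim (≢0 refl)
ownNet-owner k w e (b , own s k') ≢0 with k ≟ k'
... | no _ = ⊥-elim (≢0 refl)
... | yes refl with tail e s ≟ w
... | yes p = s , refl , p
... | no ¬p = ⊥-elim (≢0 (signed-0 (not (b xor s)) (ι-other (¬p ∘ sym))))

-- `b xor s` is true exactly when the edge points towards its owner `tail e s`. Then the other end
-- gains 1 and the owner loses 1; otherwise the signs are exchanged.
net-split : (w : Fin n) (e : Edge n) (b s : Bool) →
  net w e b ≡ signed (b xor s) (ι w (head e s)) +ℤ signed (not (b xor s)) (ι w (tail e s))
net-split w e true  true  = ℤₚ.+-comm (ι w (tail e true)) (-ℤ ι w (head e true))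
net-split w e true  false = refl
net-split w e false true  = refl
net-split w e false false = ℤₚ.+-comm (ι w (tail e false)) (-ℤ ι w (head e false))

everything : ℕ → Bool
everything _ = true

net-parts : (w : Fin n) (e : Edge n) (c : Cell) → lab c ≢ limbo →
  net w e (bit c) ≡ childNet w e c +ℤ (ownNet zero w e c +ℤ ownNet (suc zero) w e c) +ℤ blockNet everything w e (blockView c)
net-parts w e (b , limbo) nl = ⊥-elim (nl refl)
net-parts w e (b , block z) nl = sym (ℤₚ.+-identityˡ _)
net-parts w e (b , own s zero) nl = trans (net-split w e b s)
  (sym (trans (ℤₚ.+-identityʳ _) (cong (signed (b xor s) (ι w (head e s)) +ℤ_) (ℤₚ.+-identityʳ _))))
net-parts w e (b , own s (suc zero)) nl = trans (net-split w e b s)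
  (sym (trans (ℤₚ.+-identityʳ _) (cong (signed (b xor s) (ι w (head e s)) +ℤ_) (ℤₚ.+-identityˡ _))))

childNet-flip : (w : Fin n) (e : Edge n) (c : Cell) → childNet w e (not (bit c) , lab c) ≡ -ℤ childNet w e c
childNet-flip w e (b , limbo)   = refl
childNet-flip w e (b , block z) = refl
childNet-flip w e (b , own s k) = trans (cong (λ x → signed x _) (xor-notˡ b s)) (signed-not (b xor s) _)
  where
  xor-notˡ : ∀ a b → not a xor b ≡ not (a xor b)
  xor-notˡ true  true  = refl
  xor-notˡ true  false = refl
  xor-notˡ false b     = refl

childNet-child : (w : Fin n) (e : Edge n) (c : Cell) → childNet w e c ≢ 0ℤ →
  ∃[ s ] ∃[ k ] lab c ≡ own s k × w ≡ head e s
childNet-child w e (b , limbo)   ≢0 = ⊥-elim (≢0 refl)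
childNet-child w e (b , block z) ≢0 = ⊥-elim (≢0 refl)
childNet-child w e (b , own s k) ≢0 with w ≟ head e s
... | yes p = s , k , refl , p
... | no ¬p = ⊥-elim (≢0 (signed-0 (b xor s) refl))

childNet-elsewhere : (w : Fin n) (e : Edge n) (c : Cell) {s : Bool} {k : Slot} →
  lab c ≡ own s k → w ≢ head e s → childNet w e c ≡ 0ℤ
childNet-elsewhere w e (b , own s k) refl w≢ = signed-0 (b xor s) (ι-other w≢)

-- junk value for edges that are not owned
child : Edge n → Label → Fin n
child e (own s k) = head e s
child e _         = head e true

childNet-child-only : (w : Fin n) (e : Edge n) (c : Cell) → w ≢ child e (lab c) → childNet w e c ≡ 0ℤ
childNet-child-only w e (b , limbo)   w≢ = refl
childNet-child-only w e (b , block z) w≢ = refl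
childNet-child-only w e (b , own s k) w≢ = childNet-elsewhere w e (b , own s k) refl w≢

childNet-limbo : (w : Fin n) (e : Edge n) (c : Cell) → lab c ≡ limbo → childNet w e c ≡ 0ℤ
childNet-limbo w e (b , limbo) refl = refl

Unblocked : Label → Set
Unblocked (block z) = ⊥
Unblocked _         = ⊤

blockView-unblocked : (c : Cell) → Unblocked (lab c) → blockView c ≡ nothing
blockView-unblocked (b , limbo)   _ = refl
blockView-unblocked (b , own s k) _ = refl

unblocked-blockView : (c : Cell) → blockView c ≡ nothing → Unblocked (lab c)
unblocked-blockView (b , limbo)   _ = tt
unblocked-blockView (b , own s k) _ = tt

at-most-two : ∀ y → ∣ y ∣ ≤ 2 → ∣ y ∣ ≤ 1 ⊎ y ≡ + 2 ⊎ y ≡ -[1+ 1 ]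
at-most-two (+ 0) _ = inj₁ z≤n
at-most-two (+ 1) _ = inj₁ (s≤s z≤n)
at-most-two (+ 2) _ = inj₂ (inj₁ refl)
at-most-two (+ suc (suc (suc _))) (s≤s (s≤s ()))
at-most-two -[1+ 0 ] _ = inj₁ (s≤s z≤n)
at-most-two -[1+ 1 ] _ = inj₂ (inj₂ refl)
at-most-two -[1+ suc (suc _) ] (s≤s (s≤s ()))

positive-unit : ∀ y → 0ℤ ℤ.< y → ∣ y ∣ ≤ 1 → y ≡ 1ℤ
positive-unit (+ 0) (ℤ.+<+ ()) _
positive-unit (+ 1) _ _ = refl
positive-unit (+ suc (suc _)) _ (s≤s ())
positive-unit -[1+ _ ] () _

negative-unit : ∀ y → y ℤ.< 0ℤ → ∣ y ∣ ≤ 1 → y ≡ -[1+ 0 ]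
negative-unit (+ _) (ℤ.+<+ ()) _
negative-unit -[1+ 0 ] _ _ = refl
negative-unit -[1+ suc _ ] _ (s≤s ())

-- Attaching, detaching and rebalancing owned edges.

module Ownership {n m : ℕ} (E : Fin m → Edge n) where

  Config : Set
  Config = Fin m → Cell

  childSum : Config → Fin n → ℤ
  childSum t w = sum (λ i → childNet w (E i) (t i))

  Balanced : Config → Set
  Balanced t = ∀ w → ∣ childSum t w ∣ ≤ 1

  Proper : Config → Set
  Proper t = ∀ {i j s s' k} → lab (t i) ≡ own s k → lab (t j) ≡ own s' k → tail (E i) s ≡ tail (E j) s' → i ≡ j

  Free : Config → Fin n → Slot → Set
  Free t w k = ∀ {i s} → lab (t i) ≡ own s k → tail (E i) s ≢ w

  record Base (t : Config) : Set where
    field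
      proper   : Proper t
      balanced : Balanced t
  open Base public

  -- `L` restricts changes of labels only: the flips that restore balance may hit owned edges
  -- outside `L`.
  record Change (L : List (Fin m)) (t t' : Config) (c : ℕ) : Set where
    field
      labels : ∀ {i} → i ∉ L → lab (t' i) ≡ lab (t i)
      blocks : ∀ i → blockView (t' i) ≡ blockView (t i)
      cost   : flips (bit ∘ t) (bit ∘ t') ≤ c
  open Change public

  unchanged : ∀ {t} → Change [] t t 0
  unchanged .labels _ = refl
  unchanged .blocks _ = refl
  unchanged {t} .cost = ℕₚ.≤-reflexive (flips-≗ (bit ∘ t) (bit ∘ t) λ _ → refl)

  _then_ : ∀ {L L' t t' t'' c c'} → Change L t t' c → Change L' t' t'' c' → Change (L ++ L') t t'' (c + c')
  _then_ {L} p q .labels i∉ = trans (labels q (i∉ ∘ ∈-++⁺ʳ L)) (labels p (i∉ ∘ ∈-++⁺ˡ))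
  (p then q) .blocks i = trans (blocks q i) (blocks p i)
  _then_ {t = t} {t'} {t''} p q .cost =
    ℕₚ.≤-trans (flips-triangle (bit ∘ t) (bit ∘ t') (bit ∘ t'')) (ℕₚ.+-mono-≤ (cost p) (cost q))

  weaken : ∀ {L L' t t' c c'} → (∀ {i} → i ∈ L → i ∈ L') → c ≤ c' → Change L t t' c → Change L' t t' c'
  weaken L⊆ c≤ p .labels i∉ = labels p (i∉ ∘ L⊆)
  weaken L⊆ c≤ p .blocks = blocks p
  weaken L⊆ c≤ p .cost = ℕₚ.≤-trans (cost p) c≤

  childSum-update : (t t' : Config) (f : Fin m) → (∀ i → i ≢ f → t' i ≡ t i) → ∀ w →
    childSum t' w ≡ childSum t w +ℤ (childNet w (E f) (t' f) -ℤ childNet w (E f) (t f))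
  childSum-update t t' f same w = sum-update _ _ f λ i i≢f → cong (childNet w (E i)) (same i i≢f)

  flip : Config → Fin m → Config
  flip t g = updateAt t g λ c → not (bit c) , lab c

  flip-same : (t : Config) (g : Fin m) → ∀ i → i ≢ g → flip t g i ≡ t i
  flip-same t g i i≢g = updateAt-minimal i g t i≢g

  flip-labels : (t : Config) (g : Fin m) → ∀ i → lab (flip t g i) ≡ lab (t i)
  flip-labels t g i with i ≟ g
  ... | yes refl = cong lab (updateAt-updates i t)
  ... | no i≢g   = cong lab (flip-same t g i i≢g)

  -- An owned edge enters the child sum of one vertex only, the end that does not own it. Flipping
  -- it therefore repairs `x` without a chain of further repairs: the owner sees the flip only
  -- through its slot, whose share is at most 1 for either orientation.
  flip-balances : (t : Config) (x : Fin n) (g : Fin m) (c : ℤ) → childNet x (E g) (t g) ≡ c → c ≢ 0ℤ →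
    ∣ childSum t x +ℤ (-ℤ c -ℤ c) ∣ ≤ 1 → (∀ w → w ≢ x → ∣ childSum t w ∣ ≤ 1) →
    ∃[ t' ] Balanced t' × (∀ i → lab (t' i) ≡ lab (t i)) × Change [] t t' 1
  flip-balances t x g c refl c≢0 small others
    with s , k , own-g , refl ← childNet-child x (E g) (t g) c≢0 = flip t g , bal , flip-labels t g , change
    where
    new : ∀ w → childSum (flip t g) w ≡
      childSum t w +ℤ (-ℤ childNet w (E g) (t g) -ℤ childNet w (E g) (t g))
    new w = trans (childSum-update t (flip t g) g (flip-same t g) w) (cong (λ y → childSum t w +ℤ (y -ℤ childNet w (E g) (t g)))
      (trans (cong (childNet w (E g)) (updateAt-updates g t)) (childNet-flip w (E g) (t g))))
    bal : Balanced (flip t g)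
    bal w with w ≟ x
    ... | yes refl = subst (λ y → ∣ y ∣ ≤ 1) (sym (new w)) small
    ... | no w≢x = subst (λ y → ∣ y ∣ ≤ 1) (sym (trans (new w) (trans
        (cong (λ y → childSum t w +ℤ (-ℤ y -ℤ y)) (childNet-elsewhere w (E g) (t g) own-g w≢x)) (ℤₚ.+-identityʳ (childSum t w)))))
        (others w w≢x)
    change : Change [] t (flip t g) 1
    change .labels {i} _ = flip-labels t g i
    change .blocks i with i ≟ g
    ... | no i≢g = cong blockView (flip-same t g i i≢g)
    ... | yes refl = trans (blockView-unblocked (flip t g g) (subst Unblocked (sym (trans (flip-labels t g g) own-g)) tt))
                          (sym (blockView-unblocked (t g) (subst Unblocked (sym own-g) tt)))
    change .cost = flips-update _ _ g λ i i≢g → cong bit (flip-same t g i i≢g)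

  -- Only the values 2 and -2 need repair. A sum equal to 2 has a positive term, which must be 1,
  -- and flipping that edge lowers the sum by 2 to 0; the other sign is symmetric.
  rebalance : (t : Config) (x : Fin n) → ∣ childSum t x ∣ ≤ 2 → (∀ w → w ≢ x → ∣ childSum t w ∣ ≤ 1) →
    ∃[ t' ] Balanced t' × (∀ i → lab (t' i) ≡ lab (t i)) × Change [] t t' 1
  rebalance t x small others with at-most-two (childSum t x) small
  ... | inj₁ p = t , already , (λ _ → refl) , weaken (λ ()) z≤n unchanged
    where
    already : Balanced t
    already w with w ≟ x
    ... | yes refl = p
    ... | no w≢x   = others w w≢x
  ... | inj₂ (inj₁ eq) with g , pos ← positive-term (λ i → childNet x (E i) (t i)) (subst (0ℤ ℤ.<_) (sym eq) (ℤ.+<+ (s≤s z≤n))) =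
    flip-balances t x g 1ℤ (positive-unit _ pos (childNet-small x (E g) (t g))) (λ ())
      (subst (λ y → ∣ y +ℤ (-ℤ 1ℤ -ℤ 1ℤ) ∣ ≤ 1) (sym eq) z≤n) others
  ... | inj₂ (inj₂ eq) with g , neg ← negative-term (λ i → childNet x (E i) (t i)) (subst (ℤ._< 0ℤ) (sym eq) ℤ.-<+) =
    flip-balances t x g -[1+ 0 ] (negative-unit _ neg (childNet-small x (E g) (t g))) (λ ())
      (subst (λ y → ∣ y +ℤ (-ℤ -[1+ 0 ] -ℤ -[1+ 0 ]) ∣ ≤ 1) (sym eq) z≤n) others

  relabel : Config → Fin m → Label → Config
  relabel t f l = updateAt t f λ c → bit c , l

  relabel-same : (t : Config) (f : Fin m) (l : Label) → ∀ i → i ≢ f → relabel t f l i ≡ t i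
  relabel-same t f l i i≢f = updateAt-minimal i f t i≢f

  relabel-at : (t : Config) (f : Fin m) (l : Label) → relabel t f l f ≡ (bit (t f) , l)
  relabel-at t f l = updateAt-updates f t

  relabel-childSum : (t : Config) (f : Fin m) (l : Label) → ∀ w →
    childSum (relabel t f l) w ≡ childSum t w +ℤ (childNet w (E f) (bit (t f) , l) -ℤ childNet w (E f) (t f))
  relabel-childSum t f l w = trans (childSum-update t (relabel t f l) f (relabel-same t f l) w)
    (cong (λ c → childSum t w +ℤ (childNet w (E f) c -ℤ childNet w (E f) (t f))) (relabel-at t f l))

  -- A change of label without a change of bit moves the child sum of `x` alone, and by at most 1,
  -- so it leaves the range that one flip can repair only never: from at most 1 it reaches at most
  -- 2.
  relabel-rebalanced : (t : Config) (f : Fin m) (l : Label) (x : Fin n) → Balanced t →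
    Unblocked (lab (t f)) → Unblocked l →
    (∀ w → ∣ childNet w (E f) (bit (t f) , l) -ℤ childNet w (E f) (t f) ∣ ≤ 1) →
    (∀ w → w ≢ x → childNet w (E f) (bit (t f) , l) -ℤ childNet w (E f) (t f) ≡ 0ℤ) →
    ∃[ t' ] Balanced t' × lab (t' f) ≡ l × Change [ f ] t t' 1
  relabel-rebalanced t f l x bal unblocked unblocked' small elsewhere
    with t' , bal' , same-lab , change ← rebalance (relabel t f l) x
      (subst (λ y → ∣ y ∣ ≤ 2) (sym (relabel-childSum t f l x)) (∣+∣≤ (childSum t x) _ (bal x) (small x)))
      (λ w w≢x → subst (λ y → ∣ y ∣ ≤ 1) (sym (trans (relabel-childSum t f l w)
        (trans (cong (childSum t w +ℤ_) (elsewhere w w≢x)) (ℤₚ.+-identityʳ (childSum t w))))) (bal w))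
    = t' , bal' , trans (same-lab f) (cong lab (relabel-at t f l)) , (relabelled then change)
    where
    t₁ : Config
    t₁ = relabel t f l
    bits : ∀ i → bit (t₁ i) ≡ bit (t i)
    bits i with i ≟ f
    ... | yes refl = cong bit (relabel-at t f l)
    ... | no i≢f   = cong bit (relabel-same t f l i i≢f)
    relabelled : Change [ f ] t t₁ 0
    relabelled .labels {i} i∉ = cong lab (relabel-same t f l i (i∉ ∘ here))
    relabelled .blocks i with i ≟ f
    ... | no i≢f = cong blockView (relabel-same t f l i i≢f)
    ... | yes refl = trans (blockView-unblocked (t₁ f) (subst Unblocked (sym (cong lab (relabel-at t f l))) unblocked'))
                          (sym (blockView-unblocked (t f) unblocked))
    relabelled .cost = ℕₚ.≤-reflexive (flips-≗ (bit ∘ t) (bit ∘ t₁) bits)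

  limbo-difference : (t : Config) (f : Fin m) → lab (t f) ≡ limbo → ∀ w y → y -ℤ childNet w (E f) (t f) ≡ y
  limbo-difference t f is-limbo w y = trans (cong (λ x → y -ℤ x) (childNet-limbo w (E f) (t f) is-limbo)) (ℤₚ.+-identityʳ y)

  -- The edge may come with any bit. Its new share at the end opposite to the owner is at most 1,
  -- and rebalancing that end accounts for the single flip. Properness survives because the slot is
  -- free.
  attach : ∀ {t f s k} → Base t → lab (t f) ≡ limbo → Free t (tail (E f) s) k →
    ∃[ t' ] Base t' × lab (t' f) ≡ own s k × Change [ f ] t t' 1
  attach {t} {f} {s} {k} base is-limbo free
    with t' , bal' , new-lab , change ← relabel-rebalanced t f (own s k) (head (E f) s) (balanced base)
      (subst Unblocked (sym is-limbo) tt) tt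
      (λ w → subst (λ y → ∣ y ∣ ≤ 1) (sym (limbo-difference t f is-limbo w (childNet w (E f) (bit (t f) , own s k)))) (childNet-small w (E f) (bit (t f) , own s k)))
      (λ w w≢ → trans (limbo-difference t f is-limbo w (childNet w (E f) (bit (t f) , own s k))) (childNet-elsewhere w (E f) (bit (t f) , own s k) refl w≢))
    = t' , record { proper = prop t' new-lab change ; balanced = bal' } , new-lab , change
    where
    prop : (t' : Config) → lab (t' f) ≡ own s k → Change [ f ] t t' 1 → Proper t'
    prop t' new-lab change {i} {j} {s₁} {s₂} {k'} p q meet with i ≟ f | j ≟ f
    ... | yes refl | yes refl = refl
    ... | no i≢f | no j≢f = proper base (trans (sym (labels change λ { (here e) → i≢f e })) p)
                                        (trans (sym (labels change λ { (here e) → j≢f e })) q) meet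
    ... | yes refl | no j≢f with refl ← trans (sym new-lab) p =
      ⊥-elim (free (trans (sym (labels change λ { (here e) → j≢f e })) q) (sym meet))
    ... | no i≢f | yes refl with refl ← trans (sym new-lab) q =
      ⊥-elim (free (trans (sym (labels change λ { (here e) → i≢f e })) p) meet)

  detach : ∀ {t f} → Base t → blockView (t f) ≡ nothing →
    ∃[ t' ] Base t' × lab (t' f) ≡ limbo × Change [ f ] t t' 1
  detach {t} {f} base unblocked
    with t' , bal' , new-lab , change ← relabel-rebalanced t f limbo (child (E f) (lab (t f))) (balanced base)
      (unblocked-blockView (t f) unblocked) tt
      (λ w → subst (_≤ 1) (sym (trans (cong ∣_∣ (ℤₚ.+-identityˡ (-ℤ childNet w (E f) (t f)))) (ℤₚ.∣-i∣≡∣i∣ (childNet w (E f) (t f)))))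
        (childNet-small w (E f) (t f)))
      (λ w w≢ → trans (ℤₚ.+-identityˡ (-ℤ childNet w (E f) (t f))) (cong -ℤ_ (childNet-child-only w (E f) (t f) w≢)))
    = t' , record { proper = prop t' new-lab change ; balanced = bal' } , new-lab , change
    where
    prop : (t' : Config) → lab (t' f) ≡ limbo → Change [ f ] t t' 1 → Proper t'
    prop t' new-lab change {i} {j} p q meet with i ≟ f | j ≟ f
    ... | yes refl | _ = case trans (sym new-lab) p of λ ()
    ... | no i≢f | yes refl = case trans (sym new-lab) q of λ ()
    ... | no i≢f | no j≢f = proper base (trans (sym (labels change λ { (here e) → i≢f e })) p)
                                        (trans (sym (labels change λ { (here e) → j≢f e })) q) meet

  -- By properness `f` was the only edge in this slot.
  detach-frees : ∀ {t t' f s k c} → Base t → lab (t f) ≡ own s k → lab (t' f) ≡ limbo → Change [ f ] t t' c →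
    Free t' (tail (E f) s) k
  detach-frees {f = f} base was is-limbo change {i} p meet with i ≟ f
  ... | yes refl = case trans (sym is-limbo) p of λ ()
  ... | no i≢f = i≢f (proper base (trans (sym (labels change λ { (here e) → i≢f e })) p) was meet)

  detachAll : ∀ {t} L → Base t → (∀ {i} → i ∈ L → blockView (t i) ≡ nothing) →
    ∃[ t' ] Base t' × (∀ {i} → i ∈ L → lab (t' i) ≡ limbo) × Change L t t' (length L)
  detachAll {t} [] base _ = t , base , (λ ()) , unchanged
  detachAll {t} (f ∷ L) base unblocked
    with t₁ , base₁ , gone₁ , change₁ ← detachAll {t} L base (unblocked ∘ there)
    with t₂ , base₂ , gone₂ , change₂ ← detach {t₁} {f} base₁ (trans (blocks change₁ f) (unblocked (here refl)))
    = t₂ , base₂ , gone , weaken swap (ℕₚ.≤-reflexive (ℕₚ.+-comm (length L) 1)) (change₁ then change₂)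
    where
    gone : ∀ {i} → i ∈ f ∷ L → lab (t₂ i) ≡ limbo
    -- `f` may occur again in `L`, so the comparison with `f` comes before the position in the list.
    gone {i} i∈ with i ≟ f
    gone i∈          | yes refl = gone₂
    gone (here e)    | no i≢f   = ⊥-elim (i≢f e)
    gone (there i∈L) | no i≢f   = trans (labels change₂ λ { (here e) → i≢f e }) (gone₁ i∈L)
    swap : ∀ {i} → i ∈ L ++ [ f ] → i ∈ f ∷ L
    swap i∈ with ∈-++⁻ L i∈
    ... | inj₁ p        = there p
    ... | inj₂ (here e) = here e

-- Walks along owned edges, and the search for a free slot or a closed trail.

tail-not : (e : Edge n) (s : Bool) → tail e (not s) ≡ head e s
tail-not e true  = refl
tail-not e false = refl

-- Applied to edges of walks, which are owned; `zero` is a junk value for the other labels.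
slot : Label → Slot
slot (own s k) = k
slot _         = zero

-- The indices in `Fin (2 ^ K)` encode the words of `K` slots that steer the walks of the search.
words-injective : ∀ {K} {i j : Fin (2 ^ K)} → tabulate (finToFun {2} {K} i) ≡ tabulate (finToFun {2} {K} j) → i ≡ j
words-injective {K} {i} {j} eq = begin
  i                                ≡⟨ funToFin-finToFin {K} {2} i ⟨
  funToFin (finToFun {2} {K} i)    ≡⟨ funToFin-tabulate _ _ eq ⟩
  funToFin (finToFun {2} {K} j)    ≡⟨ funToFin-finToFin {K} {2} j ⟩
  j                                ∎
  where
  open ≡-Reasoning
  funToFin-tabulate : ∀ {K} (f g : Fin K → Fin 2) → tabulate f ≡ tabulate g → funToFin f ≡ funToFin g
  funToFin-tabulate {zero}  f g eq = refl
  funToFin-tabulate {suc K} f g eq with f₀≡g₀ , rest ← Listₚ.∷-injective eq =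
    cong₂ combine f₀≡g₀ (funToFin-tabulate (f ∘ suc) (g ∘ suc) rest)

module Walks {n m : ℕ} (E : Fin m → Edge n) (t : Fin m → Cell) where
  open Ownership E

  OwnedBy : Fin n → Fin m → Set
  OwnedBy u f = ∃[ s ] ∃[ k ] lab (t f) ≡ own s k × tail (E f) s ≡ u

  owner-unique : ∀ {u u' f} → OwnedBy u f → OwnedBy u' f → u ≡ u'
  owner-unique (s , k , p , refl) (s' , k' , q , refl) with refl ← trans (sym p) q = refl

  data Walk : Fin n → Fin n → List (Fin m) → Set where
    []   : ∀ {u} → Walk u u []
    step : ∀ {u w f s k P} → lab (t f) ≡ own s k → tail (E f) s ≡ u → Walk (head (E f) s) w P → Walk u w (f ∷ P)

  Avoids : Fin n → List (Fin m) → Set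
  Avoids u P = ∀ {g} → g ∈ P → ¬ OwnedBy u g

  -- Walks without repeated vertices. Each edge leaves from its owner, so `Avoids u P` and `u ≢ w`
  -- together say that `u` is not visited again.
  data Path : Fin n → Fin n → List (Fin m) → Set where
    []   : ∀ {u} → Path u u []
    step : ∀ {u w f s k P} → lab (t f) ≡ own s k → tail (E f) s ≡ u → Avoids u P → u ≢ w →
           Path (head (E f) s) w P → Path u w (f ∷ P)

  path-walk : ∀ {u w P} → Path u w P → Walk u w P
  path-walk []                     = []
  path-walk (step own-f tl _ _ p) = step own-f tl (path-walk p)

  fresh-∷ : ∀ {f : Fin m} {P} → f ∉ P → Unique P → Unique (f ∷ P)
  fresh-∷ f∉P uniq = All.tabulate (λ { g∈P refl → f∉P g∈P }) ∷ uniq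

  path-unique : ∀ {u w P} → Path u w P → Unique P
  path-unique []                          = []
  path-unique (step own-f tl avoids _ p) = fresh-∷ (λ f∈P → avoids f∈P (_ , _ , own-f , tl)) (path-unique p)

  suffix-from : ∀ u {x w P} → Path x w P → (∃[ P' ] Path u w P' × length P' ≤ length P) ⊎ (Avoids u P × u ≢ w)
  suffix-from u {x} [] with u ≟ x
  ... | yes refl = inj₁ ([] , [] , z≤n)
  ... | no u≢x   = inj₂ ((λ ()) , u≢x)
  suffix-from u {x} {P = f ∷ P} path@(step own-f tl _ _ rest) with u ≟ x
  ... | yes refl = inj₁ (_ , path , ℕₚ.≤-refl)
  ... | no u≢x with suffix-from u rest
  ... | inj₁ (P' , path' , short) = inj₁ (P' , path' , ℕₚ.m≤n⇒m≤1+n short)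
  ... | inj₂ (avoids , u≢w) = inj₂ (avoids' , u≢w)
    where
    avoids' : Avoids u (f ∷ P)
    avoids' (here refl) owned = u≢x (owner-unique owned (_ , _ , own-f , tl))
    avoids' (there g∈P) = avoids g∈P

  -- If the start recurs on the already simplified rest, the part of the rest from that visit on
  -- replaces the whole walk.
  erase-loops : ∀ {u w P} → Walk u w P → ∃[ P' ] Path u w P' × length P' ≤ length P
  erase-loops [] = [] , [] , z≤n
  erase-loops {u} (step {f = f} own-f tl rest) with P₁ , path , short ← erase-loops rest with suffix-from u path
  ... | inj₁ (P₂ , path' , short') = P₂ , path' , ℕₚ.m≤n⇒m≤1+n (ℕₚ.≤-trans short' short)
  ... | inj₂ (avoids , u≢w) = f ∷ P₁ , step own-f tl avoids u≢w path , s≤s short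

  prefix-to : ∀ x {u w P} → Path u w P →
    (∃[ P' ] Path u x P' × (∀ {g} → g ∈ P' → g ∈ P) × length P' ≤ length P) ⊎ (Avoids x P × x ≢ w)
  prefix-to x {u} [] with x ≟ u
  ... | yes refl = inj₁ ([] , [] , (λ ()) , z≤n)
  ... | no x≢u   = inj₂ ((λ ()) , x≢u)
  prefix-to x {u} {P = f ∷ P} (step own-f tl avoids u≢w rest) with x ≟ u
  ... | yes refl = inj₁ ([] , [] , (λ ()) , z≤n)
  ... | no x≢u with prefix-to x rest
  ... | inj₁ (P' , path , P'⊆P , short) =
        inj₁ (f ∷ P' , step own-f tl (avoids ∘ P'⊆P) (x≢u ∘ sym) path , sub , s≤s short)
    where
    sub : ∀ {g} → g ∈ f ∷ P' → g ∈ f ∷ P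
    sub (here e)  = here e
    sub (there p) = there (P'⊆P p)
  ... | inj₂ (avoids' , x≢w) = inj₂ (both , x≢w)
    where
    both : Avoids x (f ∷ P)
    both (here refl) owned = x≢u (owner-unique owned (_ , _ , own-f , tl))
    both (there g∈P) = avoids' g∈P

  -- A stem from u to a vertex r, and a closed trail through r that consists of the walk
  -- `left` followed by the reverse of the walk `right`.
  record Lollipop (u : Fin n) (d : ℕ) : Set where
    field
      {r v}     : Fin n
      {R P Q}   : List (Fin m)
      stem      : Walk u r R
      left      : Walk r v P
      right     : Walk r v Q
      uniqueP   : Unique P
      uniqueQ   : Unique Q
      disjoint  : ∀ {i} → i ∈ P → i ∉ Q
      fromRoot  : ∃[ f ] f ∈ P × OwnedBy r f
      shortP    : length R + length P ≤ d
      shortQ    : length R + length Q ≤ d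
  open Lollipop public

  extend : ∀ {u d f s k} → lab (t f) ≡ own s k → tail (E f) s ≡ u → Lollipop (head (E f) s) d → Lollipop u (suc d)
  extend own-f tl l = record
    { stem = step own-f tl (stem l) ; left = left l ; right = right l
    ; uniqueP = uniqueP l ; uniqueQ = uniqueQ l ; disjoint = disjoint l ; fromRoot = fromRoot l
    ; shortP = s≤s (shortP l) ; shortQ = s≤s (shortQ l) }

  -- Induction from the far end of the walk. The first time that a prepended edge starts at a vertex
  -- of the path behind it, this edge and the path up to that vertex form a closed trail with empty
  -- `right`; all edges before it become the stem.
  cycle-or-path : ∀ {u w P} → Walk u w P → Lollipop u (length P) ⊎ Path u w P
  cycle-or-path [] = inj₂ []
  cycle-or-path {u} (step {f = f} own-f tl rest) with cycle-or-path rest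
  ... | inj₁ l = inj₁ (extend own-f tl l)
  ... | inj₂ path with suffix-from u path
  ... | inj₂ (avoids , u≢w) = inj₂ (step own-f tl avoids u≢w path)
  ... | inj₁ _ with prefix-to u path
  ... | inj₂ (avoids , u≢w) = inj₂ (step own-f tl avoids u≢w path)
  ... | inj₁ (P' , path' , _ , short) = inj₁ record
    { stem = [] ; left = step own-f tl (path-walk path') ; right = []
    ; uniqueP = fresh-∷ (λ f∈P' → path-avoids-end path' f∈P' (_ , _ , own-f , tl)) (path-unique path')
    ; uniqueQ = [] ; disjoint = λ _ ()
    ; fromRoot = f , here refl , _ , _ , own-f , tl
    ; shortP = s≤s short ; shortQ = z≤n }
    where
    path-avoids-end : ∀ {u w P} → Path u w P → Avoids w P
    path-avoids-end (step own-f tl _ u≢w _) (here refl) owned = u≢w (owner-unique (_ , _ , own-f , tl) owned)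
    path-avoids-end (step _ _ _ _ p) (there g∈P) = path-avoids-end p g∈P

  -- `v` is the first vertex of the path `P` that lies on `Q`, and both paths are cut there. The
  -- edges of `P'` are owned by vertices off `Q`, which makes them distinct from all edges of `Q'`.
  meet : ∀ {x y w P Q} → Path x w P → Path y w Q →
    ∃[ v ] ∃[ P' ] ∃[ Q' ] Walk x v P' × Walk y v Q' × Unique P' × Unique Q' ×
      (∀ {i} → i ∈ P' → i ∈ P) × (∀ {i} → i ∈ Q' → i ∈ Q) × (∀ {i} → i ∈ P' → i ∉ Q') ×
      length P' ≤ length P × length Q' ≤ length Q
  meet {x} p q with prefix-to x q
  meet {x} p q | inj₁ (Q' , q' , Q'⊆Q , short) =
    x , [] , Q' , [] , path-walk q' , [] , path-unique q' , (λ ()) , Q'⊆Q , (λ ()) , z≤n , short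
  meet [] q | inj₂ (_ , x≢w) = ⊥-elim (x≢w refl)
  meet {P = f ∷ P} (step own-f tl avoids _ p) q | inj₂ (x-off-Q , _)
    with v , P' , Q' , p' , q' , uniqP , uniqQ , P'⊆P , Q'⊆Q , disj , shortP' , shortQ' ← meet p q =
    v , f ∷ P' , Q' , step own-f tl p' , q' ,
    fresh-∷ (λ f∈P' → avoids (P'⊆P f∈P') (_ , _ , own-f , tl)) uniqP , uniqQ ,
    (λ { (here e) → here e ; (there i∈) → there (P'⊆P i∈) }) , Q'⊆Q ,
    (λ { (here refl) f∈Q' → x-off-Q (Q'⊆Q f∈Q') (_ , _ , own-f , tl) ; (there i∈) → disj i∈ }) ,
    s≤s shortP' , shortQ'

  -- Common first edges go to the stem. Where the paths part, `meet` closes the trail; since both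
  -- paths avoid their start from then on, neither of the two diverging edges occurs later.
  fork : ∀ {u w P Q d} → Path u w P → Path u w Q → P ≢ Q → length P ≤ d → length Q ≤ d → Lollipop u d
  fork [] [] P≢Q _ _ = ⊥-elim (P≢Q refl)
  fork [] (step _ _ _ u≢w _) _ _ _ = ⊥-elim (u≢w refl)
  fork (step _ _ _ u≢w _) [] _ _ _ = ⊥-elim (u≢w refl)
  fork (step {f = f} own-f tl avoids _ p) (step {f = g} own-g tl' avoids' _ q) P≢Q (s≤s a) (s≤s b) with f ≟ g
  ... | yes refl with refl ← trans (sym own-f) own-g = extend own-f tl (fork p q (P≢Q ∘ cong (f ∷_)) a b)
  ... | no f≢g
    with v , P' , Q' , p' , q' , uniqP , uniqQ , P'⊆P , Q'⊆Q , disj , shortP' , shortQ' ← meet p q = record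
    { stem = [] ; left = step own-f tl p' ; right = step own-g tl' q'
    ; uniqueP = fresh-∷ (λ f∈ → avoids (P'⊆P f∈) (_ , _ , own-f , tl)) uniqP
    ; uniqueQ = fresh-∷ (λ g∈ → avoids' (Q'⊆Q g∈) (_ , _ , own-g , tl')) uniqQ
    ; disjoint = λ { (here refl) (here e) → f≢g e
                   ; (here refl) (there f∈) → avoids' (Q'⊆Q f∈) (_ , _ , own-f , tl)
                   ; (there g∈) (here refl) → avoids (P'⊆P g∈) (_ , _ , own-g , tl')
                   ; (there i∈) (there i∈') → disj i∈ i∈' }
    ; fromRoot = f , here refl , _ , _ , own-f , tl
    ; shortP = s≤s (ℕₚ.≤-trans shortP' a) ; shortQ = s≤s (ℕₚ.≤-trans shortQ' b) }

  collision : ∀ {u w P Q d} → Walk u w P → Walk u w Q → P ≢ Q → length P ≡ d → length Q ≡ d → Lollipop u d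
  collision p q P≢Q refl b with cycle-or-path p
  ... | inj₁ l = l
  ... | inj₂ p' with cycle-or-path q
  ... | inj₁ l  = subst (Lollipop _) b l
  ... | inj₂ q' = fork p' q' P≢Q ℕₚ.≤-refl (ℕₚ.≤-reflexive b)

  owned-edge : ∀ w k → Free t w k ⊎ (∃[ f ] ∃[ s ] lab (t f) ≡ own s k × tail (E f) s ≡ w)
  owned-edge w k with any? (λ f → owns? f (lab (t f)))
    where
    Owns : Fin m → Label → Set
    Owns f l = ∃[ s ] l ≡ own s k × tail (E f) s ≡ w
    owns? : ∀ f l → Dec (Owns f l)
    owns? f limbo     = no λ ()
    owns? f (block z) = no λ ()
    owns? f (own s k') with k' ≟ k | tail (E f) s ≟ w
    ... | yes refl | yes p = yes (s , refl , p)
    ... | no k'≢k  | _     = no λ { (_ , refl , _) → k'≢k refl }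
    ... | _        | no ¬p = no λ { (_ , refl , p) → ¬p p }
  ... | yes found = inj₂ found
  ... | no ¬found = inj₁ λ own-i tl → ¬found (_ , _ , own-i , tl)

  record Escape (u : Fin n) (d : ℕ) : Set where
    field
      {end}   : Fin n
      {hole}  : Slot
      {route} : List (Fin m)
      walk    : Walk u end route
      free    : Free t end hole
      short   : length route ≤ d

  -- The word `ks` prescribes the slot through which each vertex is left. The slots can be read off
  -- the resulting walk, so different words yield different walks.
  explore : ∀ u ks → Escape u (length ks) ⊎ (∃[ w ] ∃[ P ] Walk u w P × map (slot ∘ lab ∘ t) P ≡ ks)
  explore u [] = inj₂ (u , [] , [] , refl)
  explore u (k ∷ ks) with owned-edge u k
  ... | inj₁ free = inj₁ record { walk = [] ; free = free ; short = z≤n }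
  ... | inj₂ (f , s , own-f , tl) with explore (head (E f) s) ks
  ... | inj₁ e = inj₁ record { walk = step own-f tl (Escape.walk e) ; free = Escape.free e ; short = s≤s (Escape.short e) }
  ... | inj₂ (w , P , walk , eq) = inj₂ (w , f ∷ P , step own-f tl walk , cong₂ _∷_ (cong slot own-f) eq)

  search : ∀ K → n < 2 ^ K → ∀ u → Escape u K ⊎ Lollipop u K
  search K n<2^K u with all-or-some (λ i → explore u (word i))
    where
    word : Fin (2 ^ K) → List Slot
    word i = tabulate (finToFun {2} {K} i)
    all-or-some : ∀ {N} {A B : Fin N → Set} → (∀ i → A i ⊎ B i) → (∃[ i ] A i) ⊎ (∀ i → B i)
    all-or-some {zero}  _ = inj₂ λ ()
    all-or-some {suc N} h with h zero | all-or-some (h ∘ suc)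
    ... | inj₁ a | _            = inj₁ (zero , a)
    ... | inj₂ b | inj₁ (i , a) = inj₁ (suc i , a)
    ... | inj₂ b | inj₂ bs      = inj₂ λ { zero → b ; (suc i) → bs i }
  ... | inj₁ (i , e) = inj₁ (subst (Escape u) (Listₚ.length-tabulate _) e)
  -- There are more words than vertices, so two walks share their end.
  ... | inj₂ walks with i , j , i<j , same-end ← pigeonhole n<2^K (proj₁ ∘ walks)
    with walks i | walks j
  ... | w , P , p , slotsP | w' , Q , q , slotsQ with refl ← same-end =
    inj₂ (collision p q distinct (len slotsP) (len slotsQ))
    where
    distinct : P ≢ Q
    distinct refl = <⇒≢ i<j (words-injective (trans (sym slotsP) slotsQ))
    len : ∀ {P} {f : Fin K → Slot} → map (slot ∘ lab ∘ t) P ≡ tabulate f → length P ≡ K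
    len {P} eq = trans (sym (Listₚ.length-map _ P)) (trans (cong length eq) (Listₚ.length-tabulate _))

-- Blocks, and placing an edge when a free slot is in reach.

neg-difference : ∀ a b → -ℤ (a -ℤ b) ≡ b -ℤ a
neg-difference = solve-∀

-- Walks traverse an edge from its owner `tail e s` to the other end, so the bit `s` orients it
-- along the walk and `not s` against it. In this form the contributions telescope along a walk.
net-along : (x : Fin n) (e : Edge n) (d s : Bool) →
  net x e (if d then s else not s) ≡ signed d (ι x (tail e s) -ℤ ι x (head e s))
net-along x e true  s = refl
net-along x (u , v) false true  = sym (neg-difference (ι x u) (ι x v))
net-along x (u , v) false false = sym (neg-difference (ι x v) (ι x u))

signed-telescope : ∀ d a b c → signed d (a -ℤ b) +ℤ signed d (b -ℤ c) ≡ signed d (a -ℤ c)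
signed-telescope true = telescope
  where
  telescope : ∀ a b c → a -ℤ b +ℤ (b -ℤ c) ≡ a -ℤ c
  telescope = solve-∀
signed-telescope false = telescope
  where
  telescope : ∀ a b c → -ℤ (a -ℤ b) +ℤ -ℤ (b -ℤ c) ≡ -ℤ (a -ℤ c)
  telescope = solve-∀

fresh-number : (V : Fin m → Maybe (Bool × ℕ)) → ∃[ z ] ∀ {i b z'} → V i ≡ just (b , z') → z' < z
fresh-number {zero} V = 0 , λ { {()} }
fresh-number {suc m} V with fresh-number (V ∘ suc) | V zero in eq
... | z , below | nothing = z , λ { {zero} e → case trans (sym eq) e of λ () ; {suc i} e → below e }
... | z , below | just (b , z₀) = suc (z + z₀) , λ
  { {zero} e → case trans (sym eq) e of λ { refl → s≤s (ℕₚ.m≤n+m z₀ z) }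
  ; {suc i} e → ℕₚ.m≤n⇒m≤1+n (ℕₚ.≤-trans (below e) (ℕₚ.m≤m+n z z₀)) }

module Placement {n m : ℕ} (E : Fin m → Edge n) where
  open Ownership E
  open DecMembership (_≟_ {m}) using (_∈?_)

  blockSum : (ℕ → Bool) → Config → Fin n → ℤ
  blockSum p t w = sum (λ i → blockNet p w (E i) (blockView (t i)))

  -- Quantifying over sets p of blocks makes the condition stable under the removal of a block.
  Closed : Config → Set
  Closed t = ∀ p w → blockSum p t w ≡ 0ℤ

  -- A covering list is enough to bound the cost of placing a block again, and it stays valid when
  -- the block disappears. It may contain edges from outside the block.
  BlocksWithin : ℕ → Config → Set
  BlocksWithin B t = ∀ z → ∃[ L ] length L ≤ B × (∀ {i b} → blockView (t i) ≡ just (b , z) → i ∈ L)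

  record Inv (B : ℕ) (t : Config) : Set where
    field
      base   : Base t
      closed : Closed t
      within : BlocksWithin B t
  open Inv public

  Places : Fin m → Config → Config → Set
  Places f t t' = ∀ {i} → lab (t' i) ≡ limbo → lab (t i) ≡ limbo × i ≢ f

  same-blocks : ∀ {B t t'} → (∀ i → blockView (t' i) ≡ blockView (t i)) → Inv B t → Base t' → Inv B t'
  same-blocks same inv base' .base = base'
  same-blocks same inv base' .closed p w =
    trans (sum-cong-≗ (λ i → cong (blockNet p w (E i)) (same i))) (closed inv p w)
  same-blocks same inv base' .within z with L , short , covers ← within inv z = L , short , λ {i} e → covers (trans (sym (same i)) e)

  paintOne : Config → Fin m → Bool → ℕ → Config
  paintOne t f b z = updateAt t f λ _ → b , block z

  paintOne-base : ∀ {t f} b z → Base t → lab (t f) ≡ limbo → Base (paintOne t f b z)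
  paintOne-base {t} {f} b z base is-limbo = record { proper = prop ; balanced = bal }
    where
    at : paintOne t f b z f ≡ (b , block z)
    at = updateAt-updates f t
    back : ∀ {i s k} → lab (paintOne t f b z i) ≡ own s k → lab (t i) ≡ own s k
    back {i} e with i ≟ f
    ... | yes refl = case trans (sym (cong lab at)) e of λ ()
    ... | no i≢f   = trans (cong lab (sym (updateAt-minimal i f t i≢f))) e
    prop : Proper (paintOne t f b z)
    prop e e' = proper base (back e) (back e')
    bal : Balanced (paintOne t f b z)
    bal w = subst (λ y → ∣ y ∣ ≤ 1) (sum-cong-≗ same) (balanced base w)
      where
      same : ∀ i → childNet w (E i) (t i) ≡ childNet w (E i) (paintOne t f b z i)
      same i with i ≟ f
      ... | yes refl = trans (childNet-limbo w (E f) (t f) is-limbo) (sym (cong (childNet w (E f)) at))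
      ... | no i≢f   = cong (childNet w (E i)) (sym (updateAt-minimal i f t i≢f))

  module _ (t₀ : Config) where
    open Walks E t₀

    walk-owned : ∀ {u w P i} → Walk u w P → i ∈ P → ∃[ s ] ∃[ k ] lab (t₀ i) ≡ own s k
    walk-owned (step own-f _ _) (here refl) = _ , _ , own-f
    walk-owned (step _ _ walk)  (there i∈P) = walk-owned walk i∈P

    -- Starting at the far end, each edge of the walk is handed over to its other end.
    shift : ∀ {u r k P} → Base t₀ → Walk u r P → Unique P → Free t₀ r k →
      ∃[ t' ] ∃[ k' ] Base t' × Free t' u k' × (∀ {i} → lab (t' i) ≡ limbo → lab (t₀ i) ≡ limbo) ×
        Change P t₀ t' (length P * 2)
    shift base [] _ free = t₀ , _ , base , free , (λ e → e) , unchanged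
    shift {u} base (step {f = f} {s = s} {k = k₀} {P = P} own-f tl walk) (f∉ ∷ uniq) free
      with t₁ , k₁ , base₁ , free₁ , limbo₁ , change₁ ← shift base walk uniq free
      with own₁ ← trans (labels change₁ (λ f∈ → All.lookup f∉ f∈ refl)) own-f
      with t₂ , base₂ , gone₂ , change₂ ← detach {t₁} {f} base₁ (blockView-unblocked (t₁ f) (subst Unblocked (sym own₁) tt))
      with t₃ , base₃ , own₃ , change₃ ← attach {t₂} {f} {not s} {k₁} base₂ gone₂
             (λ {i} own-i at → case i ≟ f of λ
               { (yes refl) → case trans (sym gone₂) own-i of λ ()
               ; (no i≢f) → free₁ (trans (sym (labels change₂ λ { (here e) → i≢f e })) own-i) (trans at (tail-not (E f) s)) })
      = t₃ , k₀ , base₃ , free₃ , limbo₃ ,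
        weaken sub (ℕₚ.≤-reflexive (trans (ℕₚ.+-assoc (length P * 2) 1 1) (ℕₚ.+-comm (length P * 2) 2)))
          ((change₁ then change₂) then change₃)
      where
      free₃ : Free t₃ u k₀
      free₃ {i} own-i at with i ≟ f
      ... | no i≢f = detach-frees base₁ own₁ gone₂ change₂
              (trans (sym (labels change₃ λ { (here e) → i≢f e })) own-i) (trans at (sym tl))
      -- Here `f` would be a loop at `u` with `k₁ ≡ k₀`, but then the slot that `free₁` declares
      -- free is the one that `f` occupied in `t₁`.
      ... | yes refl with refl ← trans (sym own₃) own-i =
              free₁ own₁ (trans tl (trans (sym at) (tail-not (E f) s)))
      limbo₃ : ∀ {i} → lab (t₃ i) ≡ limbo → lab (t₀ i) ≡ limbo
      limbo₃ {i} e with i ≟ f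
      ... | yes refl = case trans (sym own₃) e of λ ()
      ... | no i≢f = limbo₁ (trans (sym (labels change₂ λ { (here e) → i≢f e }))
                       (trans (sym (labels change₃ λ { (here e) → i≢f e })) e))
      sub : ∀ {i} → i ∈ (P ++ [ f ]) ++ [ f ] → i ∈ f ∷ P
      sub i∈ with ∈-++⁻ (P ++ [ f ]) i∈
      ... | inj₂ (here e) = here e
      ... | inj₁ i∈' with ∈-++⁻ P i∈'
      ... | inj₁ i∈P = there i∈P
      ... | inj₂ (here e) = here e

    -- Loops are erased first, because `shift` hands each edge over once, at the price of two flips.
    -- The edge `f` is in limbo, hence not on the walk, and takes the slot freed at its first end
    -- with one more flip.
    place-free : ∀ {B r k P f} → Inv B t₀ → lab (t₀ f) ≡ limbo → Walk (tail (E f) true) r P → Free t₀ r k →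
      ∃[ t' ] Inv B t' × Places f t₀ t' × flips (bit ∘ t₀) (bit ∘ t') ≤ length P * 2 + 1
    place-free {f = f} inv is-limbo walk free
      with P' , path , short ← erase-loops walk
      with t₁ , k₁ , base₁ , free₁ , limbo₁ , change₁ ← shift (base inv) (path-walk path) (path-unique path) free
      with t₂ , base₂ , own₂ , change₂ ← attach {t₁} {f} {true} {k₁} base₁
             (trans (labels change₁ λ f∈P' → case walk-owned (path-walk path) f∈P' of λ
               { (_ , _ , e) → case trans (sym is-limbo) e of λ () }) is-limbo) free₁
      = t₂ , same-blocks (blocks (change₁ then change₂)) inv base₂ , places ,
        ℕₚ.≤-trans (cost (change₁ then change₂)) (ℕₚ.+-monoˡ-≤ 1 (ℕₚ.*-monoˡ-≤ 2 short))
      where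
      places : Places f t₀ t₂
      places {i} e with i ≟ f
      ... | yes refl = case trans (sym own₂) e of λ ()
      ... | no i≢f   = limbo₁ (trans (sym (labels change₂ λ { (here e) → i≢f e })) e) , i≢f

    -- Orients the walk forwards (d = true) or backwards and puts it into block z.
    paint : ∀ {u w P} d z t → Base t → Walk u w P → Unique P → (∀ {i} → i ∈ P → lab (t i) ≡ limbo) →
      ∃[ t' ] Base t' × (∀ {i} → i ∈ P → lab (t' i) ≡ block z) × (∀ {i} → i ∉ P → t' i ≡ t i) ×
        flips (bit ∘ t) (bit ∘ t') ≤ length P ×
        (∀ p x → blockSum p t' x ≡ blockSum p t x +ℤ (if p z then signed d (ι x u -ℤ ι x w) else 0ℤ))
    paint {u} d z t base [] _ _ = t , base , (λ ()) , (λ _ → refl) , ℕₚ.≤-reflexive (flips-≗ (bit ∘ t) (bit ∘ t) λ _ → refl) , sums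
      where
      nothing-added : ∀ x → (b : Bool) → (if b then signed d (ι x u -ℤ ι x u) else 0ℤ) ≡ 0ℤ
      nothing-added x true  = signed-0 d (ℤₚ.+-inverseʳ (ι x u))
      nothing-added x false = refl
      sums : ∀ p x → blockSum p t x ≡ blockSum p t x +ℤ (if p z then signed d (ι x u -ℤ ι x u) else 0ℤ)
      sums p x = sym (trans (cong (blockSum p t x +ℤ_) (nothing-added x (p z))) (ℤₚ.+-identityʳ (blockSum p t x)))
    paint {u} {w} d z t base (step {f = f} {s = s} {P = P} own-f tl walk) (f∉ ∷ uniq) limbos
      with t' , base' , painted , kept , cheap , sums ← paint d z (paintOne t f (if d then s else not s) z)
        (paintOne-base {t} {f} _ z base (limbos (here refl))) walk uniq
        (λ {i} i∈P → trans (cong lab (updateAt-minimal i f t λ { refl → All.lookup f∉ i∈P refl })) (limbos (there i∈P)))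
      = t' , base' , painted' , kept' ,
        ℕₚ.≤-trans (flips-triangle (bit ∘ t) (bit ∘ t₁) (bit ∘ t'))
          (ℕₚ.+-mono-≤ (flips-update (bit ∘ t) (bit ∘ t₁) f λ i i≢f → cong bit (updateAt-minimal i f t i≢f)) cheap) , sums'
      where
      b = if d then s else not s
      t₁ = paintOne t f b z
      f∉P : f ∉ P
      f∉P f∈P = All.lookup f∉ f∈P refl
      painted' : ∀ {i} → i ∈ f ∷ P → lab (t' i) ≡ block z
      painted' (here refl) = trans (cong lab (kept f∉P)) (cong lab (updateAt-updates f t))
      painted' (there i∈P) = painted i∈P
      kept' : ∀ {i} → i ∉ f ∷ P → t' i ≡ t i
      kept' {i} i∉ = trans (kept (i∉ ∘ there)) (updateAt-minimal i f t (i∉ ∘ here))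
      sum₁ : ∀ p x → blockSum p t₁ x ≡ blockSum p t x +ℤ (if p z then signed d (ι x u -ℤ ι x (head (E f) s)) else 0ℤ)
      sum₁ p x = trans (sum-update _ _ f λ i i≢f → cong (λ c → blockNet p x (E i) (blockView c)) (updateAt-minimal i f t i≢f))
        (cong (blockSum p t x +ℤ_) (trans
          (cong₂ (λ c v → blockNet p x (E f) (blockView c) -ℤ blockNet p x (E f) v) (updateAt-updates f t)
            (blockView-unblocked (t f) (subst Unblocked (sym (limbos (here refl))) tt)))
          (trans (ℤₚ.+-identityʳ _) (cong (λ y → if p z then y else 0ℤ)
            (trans (net-along x (E f) d s) (cong (λ y → signed d (ι x y -ℤ ι x (head (E f) s))) tl))))))
      sums' : ∀ p x → blockSum p t' x ≡ blockSum p t x +ℤ (if p z then signed d (ι x u -ℤ ι x w) else 0ℤ)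
      sums' p x = trans (sums p x) (trans (cong (_+ℤ (if p z then _ else 0ℤ)) (sum₁ p x))
        (trans (ℤₚ.+-assoc (blockSum p t x) _ _) (cong (blockSum p t x +ℤ_) (merge (p z)))))
        where
        merge : ∀ c → (if c then signed d (ι x u -ℤ ι x (head (E f) s)) else 0ℤ) +ℤ
                      (if c then signed d (ι x (head (E f) s) -ℤ ι x w) else 0ℤ)
                    ≡ (if c then signed d (ι x u -ℤ ι x w) else 0ℤ)
        merge true  = signed-telescope d (ι x u) (ι x (head (E f) s)) (ι x w)
        merge false = refl

-- Dissolving a block, which costs no flips since all bits stay.

unblock : ℕ → Cell → Cell
unblock z (b , block z') with z' ℕₚ.≟ z
... | yes _ = b , limbo
... | no _  = b , block z'
unblock z c = c

unblock-bit : ∀ z c → bit (unblock z c) ≡ bit c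
unblock-bit z (b , limbo)   = refl
unblock-bit z (b , own s k) = refl
unblock-bit z (b , block z') with z' ℕₚ.≟ z
... | yes _ = refl
... | no _  = refl

unblock-own : ∀ z c {s k} → lab (unblock z c) ≡ own s k → lab c ≡ own s k
unblock-own z (b , own s k) e = e
unblock-own z (b , block z') e with z' ℕₚ.≟ z
unblock-own z (b , block z') () | yes _
unblock-own z (b , block z') () | no _

unblock-limbo : ∀ z c → lab (unblock z c) ≡ limbo → lab c ≡ limbo ⊎ lab c ≡ block z
unblock-limbo z (b , limbo) e = inj₁ e
unblock-limbo z (b , block z') e with z' ℕₚ.≟ z
... | yes refl = inj₂ refl
unblock-limbo z (b , block z') () | no _

unblock-gone : ∀ {z} c → lab c ≡ block z → lab (unblock z c) ≡ limbo
unblock-gone {z} (b , block z) refl with z ℕₚ.≟ z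
... | yes _  = refl
... | no z≢z = ⊥-elim (z≢z refl)

unblock-child : ∀ z w (e : Edge n) c → childNet w e (unblock z c) ≡ childNet w e c
unblock-child z w e (b , limbo)   = refl
unblock-child z w e (b , own s k) = refl
unblock-child z w e (b , block z') with z' ℕₚ.≟ z
... | yes _ = refl
... | no _  = refl

unblock-view : ∀ z c {b z'} → blockView (unblock z c) ≡ just (b , z') → blockView c ≡ just (b , z')
unblock-view z (b , block z') e with z' ℕₚ.≟ z
unblock-view z (b , block z') () | yes _
unblock-view z (b , block z') e  | no _ = e

owned-unblocked : ∀ {l} → ∃[ s ] ∃[ k ] l ≡ own s k → Unblocked l
owned-unblocked (_ , _ , refl) = tt

_minus_ : (ℕ → Bool) → ℕ → ℕ → Bool
(p minus z) z' with z' ℕₚ.≟ z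
... | yes _ = false
... | no _  = p z'

-- The block sums after the block `z` is dissolved are the old ones for the set `p minus z`, so
-- `Closed` carries over by instantiating its set.
unblock-net : ∀ z p w (e : Edge n) c → blockNet p w e (blockView (unblock z c)) ≡ blockNet (p minus z) w e (blockView c)
unblock-net z p w e (b , limbo)   = refl
unblock-net z p w e (b , own s k) = refl
unblock-net z p w e (b , block z') with z' ℕₚ.≟ z
... | yes _ = refl
... | no _  = refl

-- Placing an edge in general.

module Insertion {n m : ℕ} (E : Fin m → Edge n) (K : ℕ) (n<2^K : n < 2 ^ K) where
  open Ownership E
  open Placement E
  open DecMembership (_≟_ {m}) using (_∈?_)

  -- Detaching the at most `K + K` edges of the trail costs one flip each, and painting them at most
  -- another one each. The left walk is painted forwards and the right one backwards, so their
  -- contributions at the ends `r` and `v` cancel.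
  make-block : ∀ t {u} → Inv (K + K) t → (l : Walks.Lollipop E t u K) →
    let D = Walks.P l ++ Walks.Q l in
    ∃[ t' ] ∃[ z ] Inv (K + K) t' × (∀ {i} → i ∈ D → lab (t' i) ≡ block z) ×
      (∀ {i} → i ∉ D → lab (t' i) ≡ lab (t i)) × flips (bit ∘ t) (bit ∘ t') ≤ (K + K) + (K + K)
  make-block t inv l
    with z , fresh ← fresh-number (blockView ∘ t)
    with t₁ , base₁ , gone₁ , change₁ ← detachAll {t} (Walks.P l ++ Walks.Q l) (base inv) (λ {i} i∈D →
           case ∈-++⁻ (Walks.P l) i∈D of λ
             { (inj₁ i∈P) → blockView-unblocked (t i) (owned-unblocked (walk-owned t (Walks.left l) i∈P))
             ; (inj₂ i∈Q) → blockView-unblocked (t i) (owned-unblocked (walk-owned t (Walks.right l) i∈Q)) })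
    with t₂ , base₂ , painted₂ , kept₂ , cheap₂ , sums₂ ←
           paint t true z t₁ base₁ (Walks.left l) (Walks.uniqueP l) (gone₁ ∘ ∈-++⁺ˡ)
    with t₃ , base₃ , painted₃ , kept₃ , cheap₃ , sums₃ ←
           paint t false z t₂ base₂ (Walks.right l) (Walks.uniqueQ l)
             (λ i∈Q → trans (cong lab (kept₂ (λ i∈P → Walks.disjoint l i∈P i∈Q))) (gone₁ (∈-++⁺ʳ (Walks.P l) i∈Q)))
    = t₃ , z , record { base = base₃ ; closed = closed₃ ; within = within₃ } , painted ,
      (λ i∉ → trans (cong lab (kept i∉)) (labels change₁ i∉)) , cheap
    where
    P = Walks.P l
    Q = Walks.Q l
    D = P ++ Q
    painted : ∀ {i} → i ∈ D → lab (t₃ i) ≡ block z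
    painted {i} i∈D with ∈-++⁻ P i∈D
    ... | inj₁ i∈P = trans (cong lab (kept₃ (Walks.disjoint l i∈P))) (painted₂ i∈P)
    ... | inj₂ i∈Q = painted₃ i∈Q
    kept : ∀ {i} → i ∉ D → t₃ i ≡ t₁ i
    kept i∉ = trans (kept₃ (i∉ ∘ ∈-++⁺ʳ P)) (kept₂ (i∉ ∘ ∈-++⁺ˡ))
    short : length D ≤ K + K
    short = subst (_≤ K + K) (sym (Listₚ.length-++ P)) (ℕₚ.+-mono-≤
      (ℕₚ.≤-trans (ℕₚ.m≤n+m (length P) (length (Walks.R l))) (Walks.shortP l)) (ℕₚ.≤-trans (ℕₚ.m≤n+m (length Q) (length (Walks.R l))) (Walks.shortQ l)))
    cancel : ∀ x b → 0ℤ +ℤ (if b then x else 0ℤ) +ℤ (if b then -ℤ x else 0ℤ) ≡ 0ℤ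
    cancel x true  = trans (cong (_+ℤ -ℤ x) (ℤₚ.+-identityˡ x)) (ℤₚ.+-inverseʳ x)
    cancel x false = refl
    closed₃ : Closed t₃
    closed₃ p w = trans (sums₃ p w) (trans (cong (_+ℤ (if p z then signed false (ι w (Walks.r l) -ℤ ι w (Walks.v l)) else 0ℤ))
      (trans (sums₂ p w) (cong (_+ℤ (if p z then ι w (Walks.r l) -ℤ ι w (Walks.v l) else 0ℤ))
        (closed (same-blocks (blocks change₁) inv base₁) p w)))) (cancel (ι w (Walks.r l) -ℤ ι w (Walks.v l)) (p z)))
    block-view : ∀ c {b z z'} → lab c ≡ block z → blockView c ≡ just (b , z') → z' ≡ z
    block-view (b , block z) refl refl = refl
    old : ∀ {i} → i ∉ D → blockView (t₃ i) ≡ blockView (t i)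
    old {i} i∉ = trans (cong blockView (kept i∉)) (blocks change₁ i)
    within₃ : BlocksWithin (K + K) t₃
    within₃ z' with z' ℕₚ.≟ z
    ... | yes refl = D , short , covers
      where
      covers : ∀ {i b} → blockView (t₃ i) ≡ just (b , z) → i ∈ D
      covers {i} e with i ∈? D
      ... | yes i∈D = i∈D
      -- Outside `D` block numbers are those of `t`, all smaller than `z`.
      ... | no i∉D  = ⊥-elim (ℕₚ.<-irrefl refl (fresh (trans (sym (old i∉D)) e)))
    ... | no z'≢z with L , L-short , L-covers ← within inv z' = L , L-short , covers
      where
      covers : ∀ {i b} → blockView (t₃ i) ≡ just (b , z') → i ∈ L
      covers {i} e with i ∈? D
      ... | yes i∈D = ⊥-elim (z'≢z (block-view (t₃ i) (painted i∈D) e))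
      ... | no i∉D  = L-covers (trans (sym (old i∉D)) e)
    cheap : flips (bit ∘ t) (bit ∘ t₃) ≤ (K + K) + (K + K)
    cheap = ℕₚ.≤-trans (flips-triangle (bit ∘ t) (bit ∘ t₁) (bit ∘ t₃)) (ℕₚ.+-mono-≤ (ℕₚ.≤-trans (cost change₁) short)
      (ℕₚ.≤-trans (flips-triangle (bit ∘ t₁) (bit ∘ t₂) (bit ∘ t₃)) (ℕₚ.≤-trans (ℕₚ.+-mono-≤ cheap₂ cheap₃)
        (subst (_≤ K + K) (Listₚ.length-++ P) short))))

  -- Cutting the walk at the first edge that has lost its owner.
  truncate : ∀ {t t' D u r R} → Walks.Walk E t u r R → (∀ {i} → i ∉ D → lab (t' i) ≡ lab (t i)) →
    (∀ {f s k} → f ∈ D → lab (t f) ≡ own s k → Free t' (tail (E f) s) k) → (∃[ k ] Free t' r k) →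
    Walks.Escape E t' u (length R)
  truncate Walks.[] same freed (k , free) = record { walk = Walks.[] ; free = free ; short = z≤n }
  truncate {t} {t'} {D} (Walks.step {f = f} own-f refl walk) same freed free with f ∈? D
  ... | yes f∈D = record { walk = Walks.[] ; free = freed f∈D own-f ; short = z≤n }
  ... | no f∉D with truncate {t} {t'} {D} walk same freed free
  ... | e = record { walk = Walks.step (trans (same f∉D) own-f) refl (Walks.Escape.walk e)
                   ; free = Walks.Escape.free e ; short = s≤s (Walks.Escape.short e) }

  -- The terms pay for making a block, for shifting ownership along at most `K` edges, and for
  -- attaching the new edge.
  placeCost : ℕ
  placeCost = (K + K) + (K + K) + (K * 2 + 1)

  -- If the search finds a closed trail, it is made a block, and the stem then leads to a free slot
  -- at the root at the latest. The stem may itself use edges of the trail, which are no longer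
  -- owned; it is cut before the first of them, whose old owner has a free slot.
  place : ∀ {t f} → Inv (K + K) t → lab (t f) ≡ limbo →
    ∃[ t' ] Inv (K + K) t' × Places f t t' × flips (bit ∘ t) (bit ∘ t') ≤ placeCost
  place {t} {f} inv is-limbo with Walks.search E t K n<2^K (tail (E f) true)
  ... | inj₁ e with t' , inv' , places , cheap ← place-free t inv is-limbo (Walks.Escape.walk e) (Walks.Escape.free e) =
    t' , inv' , places , ℕₚ.≤-trans cheap (ℕₚ.≤-trans (ℕₚ.+-monoˡ-≤ 1 (ℕₚ.*-monoˡ-≤ 2 (Walks.Escape.short e))) (ℕₚ.m≤n+m (K * 2 + 1) ((K + K) + (K + K))))
  ... | inj₂ l
    with t₁ , z , inv₁ , blocked , same , cheap₁ ← make-block t inv l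
    = via-escape (truncate {t} {t₁} (Walks.stem l) same freed root-freed)
    where
    D = Walks.P l ++ Walks.Q l
    freed : ∀ {f s k} → f ∈ D → lab (t f) ≡ own s k → Free t₁ (tail (E f) s) k
    freed {f} f∈D own-f {i} own-i at with i ∈? D
    ... | yes i∈D = case trans (sym (blocked i∈D)) own-i of λ ()
    ... | no i∉D with refl ← proper (base inv) (trans (sym (same i∉D)) own-i) own-f at = i∉D f∈D
    -- The trail contains an edge that the root owned, so the slot of that edge is now free.
    root-freed : ∃[ k ] Free t₁ (Walks.r l) k
    root-freed with g , g∈P , s , k , own-g , refl ← Walks.fromRoot l = k , freed (∈-++⁺ˡ g∈P) own-g
    not-owned : ∀ {i} → lab (t i) ≡ limbo → i ∉ D
    not-owned e i∈D with ∈-++⁻ (Walks.P l) i∈D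
    ... | inj₁ i∈P = case walk-owned t (Walks.left l) i∈P of λ { (_ , _ , o) → case trans (sym e) o of λ () }
    ... | inj₂ i∈Q = case walk-owned t (Walks.right l) i∈Q of λ { (_ , _ , o) → case trans (sym e) o of λ () }
    limbo₁ : ∀ {i} → lab (t₁ i) ≡ limbo → lab (t i) ≡ limbo
    limbo₁ {i} e with i ∈? D
    ... | yes i∈D = case trans (sym (blocked i∈D)) e of λ ()
    ... | no i∉D  = trans (sym (same i∉D)) e
    via-escape : Walks.Escape E t₁ (tail (E f) true) (length (Walks.R l)) →
      ∃[ t' ] Inv (K + K) t' × Places f t t' × flips (bit ∘ t) (bit ∘ t') ≤ placeCost
    via-escape e with t' , inv' , places , cheap ← place-free t₁ {f = f} inv₁ (trans (same (not-owned is-limbo)) is-limbo)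
                        (Walks.Escape.walk e) (Walks.Escape.free e) =
      t' , inv' , (λ l → limbo₁ (proj₁ (places l)) , proj₂ (places l)) ,
      ℕₚ.≤-trans (flips-triangle (bit ∘ t) (bit ∘ t₁) (bit ∘ t')) (ℕₚ.+-mono-≤ cheap₁ (ℕₚ.≤-trans cheap
        (ℕₚ.+-monoˡ-≤ 1 (ℕₚ.*-monoˡ-≤ 2 (ℕₚ.≤-trans (Walks.Escape.short e)
          (ℕₚ.≤-trans (ℕₚ.m≤m+n _ _) (Walks.shortP l)))))))

  -- The list that covers a dissolved block may contain edges that have a place already, or
  -- repetitions.
  place-if-needed : ∀ {t} f → Inv (K + K) t →
    ∃[ t' ] Inv (K + K) t' × Places f t t' × flips (bit ∘ t) (bit ∘ t') ≤ placeCost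
  place-if-needed {t} f inv with lab (t f) in eq
  ... | limbo   = place inv eq
  ... | own s k = t , inv , (λ e → e , λ { refl → case trans (sym eq) e of λ () }) ,
                  ℕₚ.≤-trans (ℕₚ.≤-reflexive (flips-≗ (bit ∘ t) (bit ∘ t) λ _ → refl)) z≤n
  ... | block z = t , inv , (λ e → e , λ { refl → case trans (sym eq) e of λ () }) ,
                  ℕₚ.≤-trans (ℕₚ.≤-reflexive (flips-≗ (bit ∘ t) (bit ∘ t) λ _ → refl)) z≤n

  placeAll : ∀ {t} L → Inv (K + K) t →
    ∃[ t' ] Inv (K + K) t' × (∀ {i} → lab (t' i) ≡ limbo → lab (t i) ≡ limbo × i ∉ L) ×
      flips (bit ∘ t) (bit ∘ t') ≤ length L * placeCost
  placeAll {t} [] inv = t , inv , (λ e → e , λ ()) , ℕₚ.≤-reflexive (flips-≗ (bit ∘ t) (bit ∘ t) λ _ → refl)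
  placeAll {t} (f ∷ L) inv
    with t₁ , inv₁ , places₁ , cheap₁ ← place-if-needed {t} f inv
    with t₂ , inv₂ , places₂ , cheap₂ ← placeAll {t₁} L inv₁
    = t₂ , inv₂ , (λ e → proj₁ (places₁ (proj₁ (places₂ e))) , λ
        { (here refl) → proj₂ (places₁ (proj₁ (places₂ e))) refl ; (there i∈L) → proj₂ (places₂ e) i∈L }) ,
      ℕₚ.≤-trans (flips-triangle (bit ∘ t) (bit ∘ t₁) (bit ∘ t₂)) (ℕₚ.+-mono-≤ cheap₁ cheap₂)

  dissolve : ∀ {B t} z → Inv B t → Inv B (unblock z ∘ t)
  dissolve {t = t} z inv .base .proper {i} {j} p q = proper (base inv) (unblock-own z (t i) p) (unblock-own z (t j) q)
  dissolve {t = t} z inv .base .balanced w = subst (λ y → ∣ y ∣ ≤ 1)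
    (sum-cong-≗ (λ i → sym (unblock-child z w (E i) (t i)))) (balanced (base inv) w)
  dissolve {t = t} z inv .closed p w = trans (sum-cong-≗ (λ i → unblock-net z p w (E i) (t i))) (closed inv (p minus z) w)
  dissolve {t = t} z inv .within z' with L , short , covers ← within inv z' = L , short , λ {i} e → covers (unblock-view z (t i) e)

-- Adding and removing an edge index.

dropAt-mismatches : ∀ k as bs → mismatches (dropAt k as) (dropAt k bs) ≤ mismatches as bs
dropAt-mismatches k       []       bs       = subst (_≤ 0) (sym (nothing-left (dropAt k bs))) z≤n
  where
  nothing-left : ∀ bs → mismatches [] bs ≡ 0
  nothing-left []      = refl
  nothing-left (_ ∷ _) = refl
dropAt-mismatches k       (a ∷ as) []       = subst (_≤ 0) (sym (nothing-right (dropAt k (a ∷ as)))) z≤n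
  where
  nothing-right : ∀ as → mismatches as [] ≡ 0
  nothing-right []      = refl
  nothing-right (_ ∷ _) = refl
dropAt-mismatches zero    (a ∷ as) (b ∷ bs) = ℕₚ.m≤n+m (mismatches as bs) _
dropAt-mismatches (suc k) (a ∷ as) (b ∷ bs) = ℕₚ.+-monoʳ-≤ (if a xor b then 1 else 0) (dropAt-mismatches k as bs)

mismatches-++ : ∀ as cs bs → mismatches as bs ≤ mismatches (as ++ cs) bs
mismatches-++ []       cs []       = z≤n
mismatches-++ []       cs (b ∷ bs) = z≤n
mismatches-++ (a ∷ as) cs []       = z≤n
mismatches-++ (a ∷ as) cs (b ∷ bs) = ℕₚ.+-monoʳ-≤ (if a xor b then 1 else 0) (mismatches-++ as cs bs)

dropAt-tabulate : {A : Set} (f : Fin (suc m) → A) (i : Fin (suc m)) →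
  dropAt (toℕ i) (tabulate f) ≡ tabulate (f ∘ punchIn i)
dropAt-tabulate f zero = refl
dropAt-tabulate {m = suc m} f (suc i) = cong (f zero ∷_) (dropAt-tabulate (f ∘ suc) i)

snoc : {A : Set} → (Fin m → A) → A → Fin (suc m) → A
snoc {zero}  f x _       = x
snoc {suc m} f x zero    = f zero
snoc {suc m} f x (suc i) = snoc (f ∘ suc) x i

snoc-last : {A : Set} (f : Fin m → A) (x : A) → snoc f x (fromℕ m) ≡ x
snoc-last {zero}  f x = refl
snoc-last {suc m} f x = snoc-last (f ∘ suc) x

snoc-old : {A : Set} (f : Fin m → A) (x : A) → ∀ j → snoc f x (punchIn (fromℕ m) j) ≡ f j
snoc-old {suc m} f x zero    = refl
snoc-old {suc m} f x (suc j) = snoc-old (f ∘ suc) x j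

tabulate-snoc : {A : Set} (f : Fin m → A) (x : A) → tabulate (snoc f x) ≡ tabulate f ++ [ x ]
tabulate-snoc {zero}  f x = refl
tabulate-snoc {suc m} f x = cong (f zero ∷_) (tabulate-snoc (f ∘ suc) x)

-- Translates the covering list of a block to the indices that remain when `i` is removed.
punchIn-preimages : (i : Fin (suc m)) (L : List (Fin (suc m))) →
  ∃[ L' ] length L' ≤ length L × (∀ {j} → punchIn i j ∈ L → j ∈ L')
punchIn-preimages i [] = [] , z≤n , λ ()
punchIn-preimages i (x ∷ L) with L' , short , covers ← punchIn-preimages i L with i ≟ x
... | yes refl = L' , ℕₚ.m≤n⇒m≤1+n short , λ
  { {j} (here e) → ⊥-elim (punchInᵢ≢i i j e) ; (there p) → covers p }
... | no i≢x = punchOut i≢x ∷ L' , s≤s short , λ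
  { {j} (here e) → here (punchIn-injective i j _ (trans e (sym (punchIn-punchOut i≢x)))) ; (there p) → there (covers p) }

punched : (i x : Fin (suc m)) → x ≢ i → ∃[ j ] x ≡ punchIn i j
punched i x x≢i = punchOut (x≢i ∘ sym) , sym (punchIn-punchOut (x≢i ∘ sym))

blockNet-limbo : ∀ p w (e : Edge n) c → lab c ≡ limbo → blockNet p w e (blockView c) ≡ 0ℤ
blockNet-limbo p w e (b , limbo) _ = refl

-- Serves insertion and deletion alike. An edge in limbo adds nothing to any sum and occupies no
-- slot, so the invariant passes from the smaller index set to the larger one for insertion, and
-- back for deletion.
record Drop {n m : ℕ} (i : Fin (suc m)) (E⁺ : Fin (suc m) → Edge n) (t⁺ : Fin (suc m) → Cell)
            (E : Fin m → Edge n) (t : Fin m → Cell) : Set where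
  field
    edges : ∀ j → E⁺ (punchIn i j) ≡ E j
    cells : ∀ j → t⁺ (punchIn i j) ≡ t j
    unset : lab (t⁺ i) ≡ limbo

module _ {n m : ℕ} {i : Fin (suc m)} {E⁺ : Fin (suc m) → Edge n} {t⁺ : Fin (suc m) → Cell}
         {E : Fin m → Edge n} {t : Fin m → Cell} (drop : Drop i E⁺ t⁺ E t) where
  open Drop drop
  open Ownership
  open Placement

  drop-sum : (W : Edge n → Cell → ℤ) → (∀ e c → lab c ≡ limbo → W e c ≡ 0ℤ) →
    sum (λ x → W (E⁺ x) (t⁺ x)) ≡ sum (λ j → W (E j) (t j))
  drop-sum W W-limbo = begin
    sum (λ x → W (E⁺ x) (t⁺ x))
      ≡⟨ sum-remove {i = i} (λ x → W (E⁺ x) (t⁺ x)) ⟩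
    W (E⁺ i) (t⁺ i) +ℤ sum (λ j → W (E⁺ (punchIn i j)) (t⁺ (punchIn i j)))
      ≡⟨ cong₂ _+ℤ_ (W-limbo (E⁺ i) (t⁺ i) unset) (sum-cong-≗ (λ j → cong₂ W (edges j) (cells j))) ⟩
    0ℤ +ℤ sum (λ j → W (E j) (t j))
      ≡⟨ ℤₚ.+-identityˡ _ ⟩
    sum (λ j → W (E j) (t j)) ∎
    where open ≡-Reasoning

  drop-inv : ∀ {B} → Inv E⁺ B t⁺ → Inv E B t
  drop-inv inv .base .proper {a} {b} {s} {s'} p q at = punchIn-injective i a b
    (proper (base inv) (trans (cong lab (cells a)) p) (trans (cong lab (cells b)) q)
      (trans (cong (λ e → tail e s) (edges a)) (trans at (sym (cong (λ e → tail e s') (edges b))))))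
  drop-inv inv .base .balanced w = subst (λ y → ∣ y ∣ ≤ 1) (drop-sum (childNet w) (childNet-limbo w)) (balanced (base inv) w)
  drop-inv inv .closed p w = trans (sym (drop-sum (λ e c → blockNet p w e (blockView c)) (blockNet-limbo p w))) (closed inv p w)
  drop-inv inv .within z with L , short , covers ← within inv z with L' , short' , covers' ← punchIn-preimages i L =
    L' , ℕₚ.≤-trans short' short , λ {j} e → covers' (covers (trans (cong blockView (cells j)) e))

  undrop-inv : ∀ {B} → Inv E B t → Inv E⁺ B t⁺
  undrop-inv inv .base .proper {x} {y} {s} {s'} p q at with x ≟ i | y ≟ i
  ... | yes refl | _ = case trans (sym unset) p of λ ()
  ... | no _ | yes refl = case trans (sym unset) q of λ ()
  ... | no x≢i | no y≢i with punched i x x≢i | punched i y y≢i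
  ... | a , refl | b , refl = cong (punchIn i) (proper (base inv)
    (trans (sym (cong lab (cells a))) p) (trans (sym (cong lab (cells b))) q)
    (trans (sym (cong (λ e → tail e s) (edges a))) (trans at (cong (λ e → tail e s') (edges b)))))
  undrop-inv inv .base .balanced w =
    subst (λ y → ∣ y ∣ ≤ 1) (sym (drop-sum (childNet w) (childNet-limbo w))) (balanced (base inv) w)
  undrop-inv inv .closed p w = trans (drop-sum (λ e c → blockNet p w e (blockView c)) (blockNet-limbo p w)) (closed inv p w)
  undrop-inv inv .within z with L , short , covers ← within inv z =
    map (punchIn i) L , subst (_≤ _) (sym (Listₚ.length-map (punchIn i) L)) short , covers'
    where
    covers' : ∀ {x b} → blockView (t⁺ x) ≡ just (b , z) → x ∈ map (punchIn i) L
    covers' {x} e with x ≟ i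
    ... | yes refl = case trans (sym (blockView-unblocked (t⁺ i) (subst Unblocked (sym unset) tt))) e of λ ()
    ... | no x≢i with punched i x x≢i
    ... | a , refl = ∈-map⁺ (punchIn i) (covers (trans (sym (cong blockView (cells a))) e))

-- The discrepancy bound.

outdeg-indeg : (E : Fin m → Edge n) (o : Fin m → Bool) (w : Fin n) →
  outdeg (tabulate E) (tabulate o) w ⊖ indeg (tabulate E) (tabulate o) w ≡ sum (λ i → net w (E i) (o i))
outdeg-indeg {zero}  E o w = refl
outdeg-indeg {suc m} E o w = trans (⊖-+ (indicator w (tail (E zero) (o zero))) (indicator w (head (E zero) (o zero))) _ _)
  (cong (net w (E zero) (o zero) +ℤ_) (outdeg-indeg (E ∘ suc) (o ∘ suc) w))
  where
  rearrange : ∀ a b c d → a +ℤ c -ℤ (b +ℤ d) ≡ a -ℤ b +ℤ (c -ℤ d)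
  rearrange = solve-∀
  ⊖-+ : ∀ a b c d → (a + c) ⊖ (b + d) ≡ (+ a -ℤ + b) +ℤ (c ⊖ d)
  ⊖-+ a b c d = trans (sym (ℤₚ.m-n≡m⊖n (a + c) (b + d))) (trans (rearrange (+ a) (+ b) (+ c) (+ d))
    (cong (+ a -ℤ + b +ℤ_) (ℤₚ.m-n≡m⊖n c d)))

module _ {n m : ℕ} (E : Fin m → Edge n) where
  open Ownership E
  open Placement E

  -- The bound is 1 + 1 + 1: the child sum is balanced up to 1, each of the two slots holds at most
  -- one edge, and the blocks add 0.
  discrepancy : ∀ {B} (t : Config) → Inv B t → (∀ i → lab (t i) ≢ limbo) →
    DiscrepancyAtMost 3 (tabulate E) (tabulate (bit ∘ t))
  discrepancy t inv settled w = subst (λ y → ∣ y ∣ ≤ 3) (sym total)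
    (∣+∣≤ {1} {2} (childSum t w) _ (balanced (base inv) w) (∣+∣≤ {1} {1} (ownSum zero) _ (own-small zero) (own-small (suc zero))))
    where
    ownSum : Slot → ℤ
    ownSum k = sum (λ i → ownNet k w (E i) (t i))
    own-small : ∀ k → ∣ ownSum k ∣ ≤ 1
    own-small k = sum-single _ (λ i → ownNet-small k w (E i) (t i)) single
      where
      single : ∀ i j → ownNet k w (E i) (t i) ≢ 0ℤ → ownNet k w (E j) (t j) ≢ 0ℤ → i ≡ j
      single i j p q
        with s , own-i , at-i ← ownNet-owner k w (E i) (t i) p
        with s' , own-j , at-j ← ownNet-owner k w (E j) (t j) q
        = proper (base inv) own-i own-j (trans at-i (sym at-j))
    total : outdeg (tabulate E) (tabulate (bit ∘ t)) w ⊖ indeg (tabulate E) (tabulate (bit ∘ t)) w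
      ≡ childSum t w +ℤ (ownSum zero +ℤ ownSum (suc zero))
    total = begin
      outdeg (tabulate E) (tabulate (bit ∘ t)) w ⊖ indeg (tabulate E) (tabulate (bit ∘ t)) w
        ≡⟨ outdeg-indeg E (bit ∘ t) w ⟩
      sum (λ i → net w (E i) (bit (t i)))
        ≡⟨ sum-cong-≗ (λ i → net-parts w (E i) (t i) (settled i)) ⟩
      sum (λ i → child-part i +ℤ (own-part zero i +ℤ own-part (suc zero) i) +ℤ block-part i)
        ≡⟨ ∑-distrib-+ (λ i → child-part i +ℤ (own-part zero i +ℤ own-part (suc zero) i)) block-part ⟩
      sum (λ i → child-part i +ℤ (own-part zero i +ℤ own-part (suc zero) i)) +ℤ blockSum everything t w
        ≡⟨ cong₂ _+ℤ_ (∑-distrib-+ child-part _) (closed inv everything w) ⟩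
      childSum t w +ℤ sum (λ i → own-part zero i +ℤ own-part (suc zero) i) +ℤ 0ℤ
        ≡⟨ ℤₚ.+-identityʳ _ ⟩
      childSum t w +ℤ sum (λ i → own-part zero i +ℤ own-part (suc zero) i)
        ≡⟨ cong (childSum t w +ℤ_) (∑-distrib-+ (own-part zero) (own-part (suc zero))) ⟩
      childSum t w +ℤ (ownSum zero +ℤ ownSum (suc zero)) ∎
      where
      open ≡-Reasoning
      child-part block-part : Fin m → ℤ
      child-part i = childNet w (E i) (t i)
      block-part i = blockNet everything w (E i) (blockView (t i))
      own-part : Slot → Fin m → ℤ
      own-part k i = ownNet k w (E i) (t i)

-- The dynamic algorithm.

record State {n : ℕ} (G : Graph n) (B : ℕ) : Set where
  field
    {size}  : ℕ
    ends    : Fin size → Edge n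
    cell    : Fin size → Cell
    graph   : G ≡ tabulate ends
    inv     : Placement.Inv ends B cell
    settled : ∀ i → lab (cell i) ≢ limbo
open State

output : {B : ℕ} {G : Graph n} → State G B → List Bool
output S = tabulate (bit ∘ cell S)

empty : (n B : ℕ) → State {n} [] B
empty n B = record { ends = λ () ; cell = λ () ; graph = refl ; settled = λ ()
  ; inv = record { base = record { proper = λ { {()} } ; balanced = λ _ → z≤n } ; closed = λ _ _ → refl ; within = λ _ → [] , z≤n , λ { {()} } } }

module Dynamics (n k : ℕ) (n<2^K : n < 2 ^ suc k) where
  -- `B` bounds the size of a block, all of whose edges may have to be placed in one update. As `K`
  -- is a successor, `B` is positive, and `updateCost` also covers a single placement.
  K B placeCost updateCost : ℕ
  K = suc k
  B = K + K
  placeCost = (K + K) + (K + K) + (K * 2 + 1)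
  updateCost = B * placeCost

  insert : {m : ℕ} (E : Fin m → Edge n) (t : Fin m → Cell) (e : Edge n) → Placement.Inv E B t → (∀ i → lab (t i) ≢ limbo) →
    ∃[ t' ] Placement.Inv (snoc E e) B t' × (∀ i → lab (t' i) ≢ limbo) × mismatches (tabulate (bit ∘ t)) (tabulate (bit ∘ t')) ≤ updateCost
  insert {m} E t e inv settled
    -- The new edge enters in limbo with the arbitrary bit `true`. A later change of this bit is not
    -- recourse, so the last position is discarded from the count in `cheap'`.
    with t' , inv' , places , cheap ← Insertion.place (snoc E e) K n<2^K {snoc t (true , limbo)} {fromℕ m}
      (undrop-inv {E⁺ = snoc E e} {t⁺ = snoc t (true , limbo)} {E = E} {t = t}
        (record { edges = snoc-old E e ; cells = snoc-old t (true , limbo) ; unset = cong lab (snoc-last t (true , limbo)) }) inv)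
      (cong lab (snoc-last t (true , limbo)))
    = t' , inv' , settled' , cheap'
    where
    settled' : ∀ i → lab (t' i) ≢ limbo
    settled' i e with was-limbo , i≢last ← places e with punched (fromℕ m) i i≢last
    ... | j , refl = settled j (trans (cong lab (sym (snoc-old t (true , limbo) j))) was-limbo)
    old-bits : tabulate (bit ∘ snoc t (true , limbo)) ≡ tabulate (bit ∘ t) ++ [ true ]
    old-bits = trans (sym (Listₚ.map-tabulate (snoc t (true , limbo)) bit)) (trans (cong (map bit) (tabulate-snoc t (true , limbo)))
      (trans (Listₚ.map-++ bit (tabulate t) _) (cong (_++ [ true ]) (Listₚ.map-tabulate t bit))))
    cheap' : mismatches (tabulate (bit ∘ t)) (tabulate (bit ∘ t')) ≤ updateCost
    cheap' = ℕₚ.≤-trans (mismatches-++ (tabulate (bit ∘ t)) [ true ] _)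
      (subst (λ bs → mismatches bs (tabulate (bit ∘ t')) ≤ updateCost) old-bits
        (ℕₚ.≤-trans cheap (ℕₚ.m≤m+n placeCost ((k + K) * placeCost))))

  delete : {m : ℕ} (E : Fin (suc m) → Edge n) (t : Fin (suc m) → Cell) (i : Fin (suc m)) → Placement.Inv E B t →
    (∀ i → lab (t i) ≢ limbo) →
    ∃[ t' ] Placement.Inv (E ∘ punchIn i) B t' × (∀ j → lab (t' j) ≢ limbo) × flips (bit ∘ t ∘ punchIn i) (bit ∘ t') ≤ updateCost
  delete E t i inv settled with lab (t i) in eq
  ... | limbo = ⊥-elim (settled i eq)
  -- One flip rebalances the end that did not own the edge.
  ... | own s slot
    with t₁ , base₁ , gone , change ← Ownership.detach E {t} {i} (Placement.base inv)
           (blockView-unblocked (t i) (subst Unblocked (sym eq) tt))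
    = t₁ ∘ punchIn i ,
      drop-inv (record { edges = λ _ → refl ; cells = λ _ → refl ; unset = gone })
        (Placement.same-blocks E (Ownership.blocks change) inv base₁) ,
      (λ j e → settled (punchIn i j) (trans (sym (Ownership.labels change λ { (here p) → punchInᵢ≢i i j p })) e)) ,
      subst₂ (λ as bs → mismatches as bs ≤ updateCost) (dropAt-tabulate (bit ∘ t) i) (dropAt-tabulate (bit ∘ t₁) i)
        (ℕₚ.≤-trans (dropAt-mismatches (toℕ i) (tabulate (bit ∘ t)) (tabulate (bit ∘ t₁)))
          (ℕₚ.≤-trans (Ownership.cost change) (s≤s z≤n)))
  ... | block z
    with L , short , covers ← Placement.within inv z
    with L' , short' , covers' ← punchIn-preimages i L
    with t₂ , inv₂ , places , cheap ← Insertion.placeAll (E ∘ punchIn i) K n<2^K {unblock z ∘ t ∘ punchIn i} L'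
           (drop-inv (record { edges = λ _ → refl ; cells = λ _ → refl ; unset = unblock-gone (t i) eq })
             (Insertion.dissolve E K n<2^K z inv))
    = t₂ , inv₂ , settled' ,
      subst (λ as → mismatches as (tabulate (bit ∘ t₂)) ≤ updateCost)
        (Listₚ.tabulate-cong (λ j → unblock-bit z (t (punchIn i j))))
        (ℕₚ.≤-trans cheap (ℕₚ.*-monoˡ-≤ placeCost (ℕₚ.≤-trans short' short)))
    where
    in-block : ∀ c → lab c ≡ block z → ∃[ b ] blockView c ≡ just (b , z)
    in-block (b , block z) refl = b , refl
    settled' : ∀ j → lab (t₂ j) ≢ limbo
    settled' j e with was-limbo , j∉L' ← places e with unblock-limbo z (t (punchIn i j)) was-limbo
    ... | inj₁ p = settled (punchIn i j) p
    ... | inj₂ p = j∉L' (covers' (covers (proj₂ (in-block (t (punchIn i j)) p))))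

  update : {G : Graph n} (S : State G B) (u : Update G) →
    Σ[ S' ∈ State (apply G u) B ] recourse u (output S) (output S') ≤ updateCost
  update record { ends = E ; cell = t ; graph = refl ; inv = inv ; settled = settled } (ins e)
    with t' , inv' , settled' , cheap ← insert E t e inv settled
    = record { ends = snoc E e ; cell = t' ; graph = sym (tabulate-snoc E e) ; inv = inv' ; settled = settled' } , cheap
  update record { size = suc m ; ends = E ; cell = t ; graph = refl ; inv = inv ; settled = settled } (del i)
    with t' , inv' , settled' , cheap ← delete E t (cast (Listₚ.length-tabulate E) i) inv settled
    = record { ends = E ∘ punchIn i' ; cell = t' ; graph = drop-at E ; inv = inv' ; settled = settled' } ,
      subst (λ bs → mismatches bs (tabulate (bit ∘ t')) ≤ updateCost) (sym (drop-at (bit ∘ t))) cheap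
    where
    i' = cast (Listₚ.length-tabulate E) i
    drop-at : {A : Set} (f : Fin (suc m) → A) → dropAt (toℕ i) (tabulate f) ≡ tabulate (f ∘ punchIn i')
    drop-at f = trans (cong (λ x → dropAt x (tabulate f)) (sym (toℕ-cast (Listₚ.length-tabulate E) i))) (dropAt-tabulate f i')

  run : {G : Graph n} → History n G → State G B
  run start   = empty n B
  run (h ▷ u) = proj₁ (update (run h) u)

output-length : {B : ℕ} {G : Graph n} (S : State G B) → length (output S) ≡ length G
output-length record { ends = E ; graph = refl } = trans (Listₚ.length-tabulate _) (sym (Listₚ.length-tabulate E))

output-discrepancy : {B : ℕ} {G : Graph n} (S : State G B) → DiscrepancyAtMost 3 G (output S)
output-discrepancy record { ends = E ; cell = t ; graph = refl ; inv = inv ; settled = settled } =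
  discrepancy E t inv settled

-- The choice of `K` and the final constants.

n<2^[1+log₂n] : ∀ n → n < 2 ^ suc ⌊log₂ n ⌋
n<2^[1+log₂n] n = ℕₚ.≰⇒> λ 2^≤n → ℕₚ.1+n≰n (subst (_≤ ⌊log₂ n ⌋) (⌊log₂[2^n]⌋≡n (suc ⌊log₂ n ⌋)) (⌊log₂⌋-mono-≤ 2^≤n))

module Carpooling (n : ℕ) = Dynamics n ⌊log₂ n ⌋ (n<2^[1+log₂n] n)

-- For `n` at least 2 the logarithm `l` is at least 1, so `K` is at most `2 * l` and the summand 1
-- at most `2 * l`. The factors become `4 * l` and `(8 + 4 + 2) * l`, whence 56.
updateCost-bound : ∀ n → 2 ≤ n → Carpooling.updateCost n ≤ 56 * (⌊log₂ n ⌋ ^ 2)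
updateCost-bound n 2≤n = begin
  (suc l + suc l) * ((suc l + suc l) + (suc l + suc l) + (suc l * 2 + 1))
    ≤⟨ ℕₚ.*-mono-≤ (ℕₚ.+-mono-≤ K≤ K≤) (ℕₚ.+-mono-≤ (ℕₚ.+-mono-≤ (ℕₚ.+-mono-≤ K≤ K≤) (ℕₚ.+-mono-≤ K≤ K≤))
        (ℕₚ.+-mono-≤ (ℕₚ.*-monoˡ-≤ 2 K≤) (ℕₚ.≤-trans 1≤l (ℕₚ.m≤m+n l l)))) ⟩
  ((l + l) + (l + l)) * (((l + l) + (l + l)) + ((l + l) + (l + l)) + ((l + l) * 2 + (l + l)))
    ≡⟨ collect l ⟩
  56 * (l ^ 2) ∎
  where
  open ℕₚ.≤-Reasoning
  l = ⌊log₂ n ⌋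
  1≤l : 1 ≤ l
  1≤l = ⌊log₂⌋-mono-≤ 2≤n
  K≤ : suc l ≤ l + l
  K≤ = ℕₚ.+-monoˡ-≤ l 1≤l
  collect : ∀ l → ((l + l) + (l + l)) * (((l + l) + (l + l)) + ((l + l) + (l + l)) + ((l + l) * 2 + (l + l))) ≡ 56 * (l * (l * 1))
  collect = ℕ-solve-∀

theorem1 : Σ[ A ∈ Algorithm ] Σ[ C ∈ ℕ ] Σ[ N ∈ ℕ ]
    ( ((n : ℕ) → {G : Graph n} → (h : History n G) →
    (length (A n h) ≡ length G) × DiscrepancyAtMost 3 G (A n h))
    × ((n : ℕ) → N ≤ n → {G : Graph n} → (h : History n G) → (u : Update G) →
    recourse u (A n h) (A n (h ▷ u)) ≤ C * (⌊log₂ n ⌋ ^ 2)) )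
theorem1 = (λ n h → output (Carpooling.run n h)) , 56 , 2 ,
  (λ n h → output-length (Carpooling.run n h) , output-discrepancy (Carpooling.run n h)) ,
  (λ n 2≤n h u → ℕₚ.≤-trans (proj₂ (Carpooling.update n (Carpooling.run n h) u)) (updateCost-bound n 2≤n))
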